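{- Let $Q$ be a quiver and let $\mathbf{i}=(i_1,i_2,\dots,i_{\ell-1},i_\ell)$ be a maximal green sequence of $Q$ with induced permutation $\sigma$. Then $(\sigma(i_\ell),i_1,i_2,\dots,i_{\ell-1})$ is a maximal green sequence for the quiver $\mu_{\sigma(i_\ell)}(Q)$, with the same induced permutation $\sigma$.
   Context: A quiver is a finite directed multigraph with no loops and no oriented 2-cycles. Mutation $\mu_k$: for every path $i\to k\to j$ add an arrow $i\to j$, reverse all arrows at $k$, delete a maximal collection of oriented 2-cycles (and arrows between frozen vertices). The framed quiver $\hat Q$ adds, for each vertex $i$ of $Q$, a frozen (never mutated) vertex $i'$ and an arrow $i\to i'$. In a quiver obtained from $\hat Q$ by mutations at non-frozen vertices, a non-frozen vertex $i$ is green if there is no arrow $j'\to i$ from a frozen vertex and red if there is no arrow $i\to j'$ to a frozen vertex. $(i_1,\dots,i_l)$ is a maximal green sequence if each $i_t$ is green in $\mu_{i_{t-1}}\cdots\mu_{i_1}(\hat Q)$ and every non-frozen vertex of the final quiver is red. It is known that if $\mathbf{i}$ is a maximal green sequence then $\mu_{\mathbf{i}}(Q)=\mu_{i_\ell}\cdots\mu_{i_1}(Q)$ is isomorphic to $Q$; the induced permutation $\sigma$ is the permutation of the vertices such that relabelling $\mu_{\mathbf{i}}(Q)$ by $\sigma$ gives $Q$, i.e. $\sigma(\mu_{\mathbf{i}}(Q))=Q$.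
   Formalization: The induced permutation is taken as the σ that relabels the final framed quiver, frozen vertices fixed, to the coframed quiver of Q (arrows i'→i); σ(μ_i(Q))=Q alone does not determine σ when Q has automorphisms, and the claim can then fail. -}

module Defs where

open import Data.Nat using (ℕ; zero; suc; _+_; _*_; _∸_)
open import Data.Fin using (Fin)
open import Data.Fin.Properties using () renaming (_≟_ to _≟F_)
open import Data.Fin.Permutation using (Permutation′; _⟨$⟩ʳ_)
open import Data.Sum using (_⊎_; inj₁; inj₂)
open import Data.Sum.Properties using (≡-dec)
open import Data.Product using (_×_)
open import Data.List using (List; []; _∷_)
open import Data.Unit using (⊤)
open import Relation.Binary.PropositionalEquality using (_≡_)
open import Relation.Binary.Definitions using (DecidableEquality)
open import Relation.Nullary using (yes; no)

-- A (multi)quiver on vertex type V, given by the number of arrows a x y from x to y.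
QuiverOn : Set → Set
QuiverOn V = V → V → ℕ

IsQuiver : {V : Set} → QuiverOn V → Set
IsQuiver {V} a = (∀ (x : V) → a x x ≡ 0) × (∀ (x y : V) → (a x y ≡ 0) ⊎ (a y x ≡ 0))

-- Mutation at k: add an arrow x→y for each path x→k→y, reverse arrows at k,
-- then delete a maximal collection of oriented 2-cycles.
mutate : {V : Set} → DecidableEquality V → V → QuiverOn V → QuiverOn V
mutate _≟_ k a x y with x ≟ k | y ≟ k
... | yes _ | _     = a y k
... | no _  | yes _ = a k x
... | no _  | no _  = (a x y + a x k * a k y) ∸ (a y x + a y k * a k x)

Quiver : ℕ → Set
Quiver n = QuiverOn (Fin n)

μ : ∀ {n} → Fin n → Quiver n → Quiver n
μ = mutate _≟F_

-- Quivers with n non-frozen vertices inj₁ i and n frozen vertices inj₂ i (= i').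
FVert : ℕ → Set
FVert n = Fin n ⊎ Fin n

FQuiver : ℕ → Set
FQuiver n = QuiverOn (FVert n)

dropFrozen : ∀ {n} → FQuiver n → FQuiver n
dropFrozen a (inj₂ _) (inj₂ _) = 0
dropFrozen a x y = a x y

μF : ∀ {n} → Fin n → FQuiver n → FQuiver n
μF k a = dropFrozen (mutate (≡-dec _≟F_ _≟F_) (inj₁ k) a)

δ : ∀ {n} → Fin n → Fin n → ℕ
δ i j with i ≟F j
... | yes _ = 1
... | no _  = 0

framed : ∀ {n} → Quiver n → FQuiver n
framed a (inj₁ i) (inj₁ j) = a i j
framed a (inj₁ i) (inj₂ j) = δ i j
framed a (inj₂ _) _        = 0

coframed : ∀ {n} → Quiver n → FQuiver n
coframed a (inj₁ i) (inj₁ j) = a i j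
coframed a (inj₂ i) (inj₁ j) = δ i j
coframed a _        (inj₂ _) = 0

Green : ∀ {n} → FQuiver n → Fin n → Set
Green {n} a i = ∀ (j : Fin n) → a (inj₂ j) (inj₁ i) ≡ 0

Red : ∀ {n} → FQuiver n → Fin n → Set
Red {n} a i = ∀ (j : Fin n) → a (inj₁ i) (inj₂ j) ≡ 0

μSeqF : ∀ {n} → List (Fin n) → FQuiver n → FQuiver n
μSeqF []       a = a
μSeqF (k ∷ ks) a = μSeqF ks (μF k a)

μSeq : ∀ {n} → List (Fin n) → Quiver n → Quiver n
μSeq []       a = a
μSeq (k ∷ ks) a = μSeq ks (μ k a)

GreenSeq : ∀ {n} → FQuiver n → List (Fin n) → Set
GreenSeq a []       = ⊤
GreenSeq a (k ∷ ks) = Green a k × GreenSeq (μF k a) ks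

IsMaxGreenSeq : ∀ {n} → Quiver n → List (Fin n) → Set
IsMaxGreenSeq {n} Q is = GreenSeq (framed Q) is × (∀ (i : Fin n) → Red (μSeqF is (framed Q)) i)

liftPerm : ∀ {n} → Permutation′ n → FVert n → FVert n
liftPerm σ (inj₁ i) = inj₁ (σ ⟨$⟩ʳ i)
liftPerm σ (inj₂ i) = inj₂ i

IsInducedPerm : ∀ {n} → Quiver n → List (Fin n) → Permutation′ n → Set
IsInducedPerm {n} Q is σ =
  ∀ (x y : FVert n) → coframed Q (liftPerm σ x) (liftPerm σ y) ≡ μSeqF is (framed Q) x y

{-# OPTIONS --safe #-}
-- As long as only green vertices are mutated, c-vectors mutate linearly, so the new sequence runs through
-- the same vectors c_t of the lattice as the old one; only the coordinates change, from the basis e of Q to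
-- the basis e′ of μ_k Q, where k = σ(i_ℓ), e′_k = - e_k and e′_x = e_x + Q(k,x) e_k. Since the last vector
-- crossed is e_k, the final vectors are - e′_{σ x}, which gives the induced permutation. What remains is that
-- the e′_k-coordinate of every vector crossed before the last one is nonnegative.
--
-- This is derived from the Laurent phenomenon. Fix a vector g of the dual lattice, nonnegative on an initial
-- seed. It is the exponent of a cluster monomial, which stays a Laurent polynomial in every later cluster and in all
-- its neighbours: the exceptional divisors defining these conditions are preserved by mutation. If l is a
-- linear form positive on all vectors crossed so far, the part of level l ≤ 0 of this polynomial remains
-- the initial monomial. For a vector γ of the current seed with l(γ) = 0 and g(γ) < 0, Laurentness in the
-- cluster mutated at γ would make that part divisible by 1 + ŷ^γ, which a monomial is not. Hence g(γ) ≥ 0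
-- (`positivity`). One application, with l the sum of the coordinates off e_k, shows that no earlier
-- crossed vector is a multiple of e_k; another one, with g the e′_k-coordinate, shows that this
-- coordinate is nonnegative.
module Submission where

open import Defs
open import Algebra.Bundles using (AbelianGroup; CommutativeMonoid; CommutativeRing)
open import Algebra.Structures using (IsAbelianGroup)
open import Data.Bool using (Bool; true; false; _xor_; _∧_)
open import Data.Bool.Properties using (xor-same; xor-assoc; xor-comm; xor-identityʳ; xor-∧-commutativeRing)
open import Data.Fin using (Fin; zero; suc)
open import Data.Fin.Permutation using (Permutation′; _⟨$⟩ʳ_; _⟨$⟩ˡ_) renaming (inverseˡ to permutation-inverseˡ)
open import Data.Fin.Properties using (_≟_)
open import Data.Integer as ℤ using (ℤ; +_; -[1+_]; +[1+_]; 0ℤ; 1ℤ; ∣_∣)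
import Data.Integer.Properties as ℤ
open import Data.Integer.Tactic.RingSolver using (solve-∀)
open import Data.List using (List; []; _∷_; [_]; _++_; map; concatMap)
open import Data.List.Properties using (++-identityʳ; ++-assoc)
open import Data.List.Relation.Unary.All as All using (All; []; _∷_)
open import Data.List.Relation.Unary.All.Properties using (++⁺; map⁺)
open import Data.Nat as ℕ using (ℕ; zero; suc; _∸_)
import Data.Nat.Properties as ℕ
open import Data.Product using (∃; _×_; _,_; proj₁; proj₂)
open import Data.Sum using (_⊎_; inj₁; inj₂)
open import Data.Sum.Properties using (≡-dec; inj₁-injective)
open import Data.Unit using (⊤; tt)
open import Data.Vec using (Vec; lookup; tabulate; zipWith; replicate)
import Data.Vec as Vec
import Data.Vec.Properties as Vec
open import Relation.Binary.Definitions using (DecidableEquality)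
open import Relation.Binary.PropositionalEquality hiding ([_])
open import Relation.Nullary using (¬_; Dec; yes; no; contradiction; ⌊_⌋)

open import Algebra.Properties.CommutativeMonoid.Sum ℤ.+-0-commutativeMonoid
  using (sum; sum-cong-≗; ∑-distrib-+; ∑-comm; sum-replicate-zero)

import Algebra.Properties.CommutativeSemigroup
  (CommutativeMonoid.commutativeSemigroup (CommutativeRing.+-commutativeMonoid xor-∧-commutativeRing)) as Xor

private variable
  A B : Set

-- A list of lattice vectors stands for a Laurent polynomial over 𝔽₂. It is only used through the pairing
-- ∑ W with 𝔽₂-valued functions, for which repeated vectors cancel.
∑ : List A → (A → Bool) → Bool
∑ []       f = false
∑ (a ∷ as) f = f a xor ∑ as f

∑-cong : ∀ {f g : A → Bool} (as : List A) → All (λ a → f a ≡ g a) as → ∑ as f ≡ ∑ as g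
∑-cong []       []       = refl
∑-cong (a ∷ as) (e ∷ es) = cong₂ _xor_ e (∑-cong as es)

∑-cong-≗ : ∀ {f g : A → Bool} (as : List A) → f ≗ g → ∑ as f ≡ ∑ as g
∑-cong-≗ as e = ∑-cong as (All.universal e as)

∑-zero : ∀ {f : A → Bool} (as : List A) → All (λ a → f a ≡ false) as → ∑ as f ≡ false
∑-zero []       []       = refl
∑-zero (a ∷ as) (e ∷ es) = cong₂ _xor_ e (∑-zero as es)

∑-xor : ∀ (f g : A → Bool) as → ∑ as (λ a → f a xor g a) ≡ ∑ as f xor ∑ as g
∑-xor f g []       = refl
∑-xor f g (a ∷ as) = trans (cong ((f a xor g a) xor_) (∑-xor f g as)) (Xor.interchange (f a) _ _ _)

∑-++ : ∀ (f : A → Bool) as bs → ∑ (as ++ bs) f ≡ ∑ as f xor ∑ bs f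
∑-++ f []       bs = refl
∑-++ f (a ∷ as) bs = trans (cong (f a xor_) (∑-++ f as bs)) (sym (xor-assoc (f a) _ _))

∑-map : ∀ (f : B → Bool) (g : A → B) as → ∑ (map g as) f ≡ ∑ as (λ a → f (g a))
∑-map f g []       = refl
∑-map f g (a ∷ as) = cong (f (g a) xor_) (∑-map f g as)

∑-concatMap : ∀ (f : B → Bool) (g : A → List B) as →
              ∑ (concatMap g as) f ≡ ∑ as (λ a → ∑ (g a) f)
∑-concatMap f g []       = refl
∑-concatMap f g (a ∷ as) =
  trans (∑-++ f (g a) (concatMap g as)) (cong (∑ (g a) f xor_) (∑-concatMap f g as))

eventually-bounded : (f : A → ℕ) (as : List A) → ∃ λ K₀ → ∀ K → K₀ ℕ.≤ K → All (λ a → f a ℕ.≤ K) as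
eventually-bounded f []       = 0 , λ _ _ → []
eventually-bounded f (a ∷ as) with eventually-bounded f as
... | K₀ , b = f a ℕ.+ K₀ , λ K le →
  ℕ.≤-trans (ℕ.m≤m+n (f a) K₀) le ∷ b K (ℕ.≤-trans (ℕ.m≤n+m K₀ (f a)) le)

≤⇒∃+ : ∀ {i j} → i ℤ.≤ j → ∃ λ k → j ≡ i ℤ.+ + k
≤⇒∃+ {i} {j} le = ∣ j ℤ.- i ∣ , (begin
  j                       ≡⟨ lem i j ⟩
  i ℤ.+ (j ℤ.- i)         ≡⟨ cong (λ z → i ℤ.+ z) (ℤ.0≤i⇒+∣i∣≡i (ℤ.i≤j⇒0≤j-i le)) ⟨
  i ℤ.+ + ∣ j ℤ.- i ∣     ∎)
  where
  open ≡-Reasoning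
  lem : ∀ i j → j ≡ i ℤ.+ (j ℤ.- i)
  lem = solve-∀

∃-shifted : ∀ z n K → ∣ z ∣ ℕ.+ n ℕ.≤ K → ∃ λ k → + (k ℕ.+ n) ≡ + K ℤ.+ z
∃-shifted (+ a) n K le with ≤⇒∃+ (ℤ.+≤+ (ℕ.≤-trans (ℕ.m≤n+m n a) le))
... | k , e = k ℕ.+ a , (begin
  + (k ℕ.+ a ℕ.+ n)             ≡⟨ lem (+ k) (+ a) (+ n) ⟩
  + n ℤ.+ + k ℤ.+ + a           ≡⟨ cong (ℤ._+ + a) e ⟨
  + K ℤ.+ + a                   ∎)
  where
  open ≡-Reasoning
  lem : ∀ k a n → k ℤ.+ a ℤ.+ n ≡ n ℤ.+ k ℤ.+ a
  lem = solve-∀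
∃-shifted -[1+ a ] n K le with ≤⇒∃+ (ℤ.+≤+ le)
... | k , e = k , (begin
  + k ℤ.+ + n                                       ≡⟨ lem (+ k) (+ n) +[1+ a ] ⟩
  (+[1+ a ] ℤ.+ + n ℤ.+ + k) ℤ.+ ℤ.- +[1+ a ]       ≡⟨ cong (ℤ._+ -[1+ a ]) e ⟨
  + K ℤ.+ -[1+ a ]                                  ∎)
  where
  open ≡-Reasoning
  lem : ∀ k n a → k ℤ.+ n ≡ (a ℤ.+ n ℤ.+ k) ℤ.+ ℤ.- a
  lem = solve-∀

Eventually : (ℕ → Set) → Set
Eventually P = ∃ λ K₀ → ∀ K → K₀ ℕ.≤ K → P K

n≤2^n : ∀ n → n ℕ.≤ 2 ℕ.^ n
n≤2^n zero    = ℕ.z≤n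
n≤2^n (suc n) = ℕ.≤-trans (ℕ.+-mono-≤ (ℕ.m^n>0 2 n) (n≤2^n n))
  (ℕ.≤-reflexive (cong (2 ℕ.^ n ℕ.+_) (sym (ℕ.+-identityʳ (2 ℕ.^ n)))))

-∣i∣≤i : ∀ i → ℤ.- + ∣ i ∣ ℤ.≤ i
-∣i∣≤i (+ n)    = ℤ.neg-≤-pos {n} {n}
-∣i∣≤i -[1+ n ] = ℤ.≤-refl

i≤∣i∣ : ∀ i → i ℤ.≤ + ∣ i ∣
i≤∣i∣ (+ n)    = ℤ.≤-refl
i≤∣i∣ -[1+ n ] = ℤ.-≤+

0≤i+j : ∀ i {j} → + ∣ i ∣ ℤ.≤ j → 0ℤ ℤ.≤ i ℤ.+ j
0≤i+j i le = ℤ.≤-trans (ℤ.≤-reflexive (sym (ℤ.+-inverseˡ (+ ∣ i ∣)))) (ℤ.+-mono-≤ (-∣i∣≤i i) le)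

0≤i+2^a*j : ∀ i a j → ∣ i ∣ ℕ.≤ a → 0ℤ ℤ.≤ i ℤ.+ + (2 ℕ.^ a) ℤ.* + suc j
0≤i+2^a*j i a j le = 0≤i+j i (ℤ.≤-trans (ℤ.+≤+ (ℕ.≤-trans (ℕ.≤-trans le (n≤2^n a)) (ℕ.m≤m*n (2 ℕ.^ a) (suc j))))
  (ℤ.≤-reflexive (ℤ.pos-* (2 ℕ.^ a) (suc j))))

sum-zero : ∀ {n} (t : Fin n → ℤ) → (∀ j → t j ≡ 0ℤ) → sum t ≡ 0ℤ
sum-zero {n} t z = trans (sum-cong-≗ z) (sum-replicate-zero n)

sum-single : ∀ {n} (t : Fin n → ℤ) x → (∀ j → j ≢ x → t j ≡ 0ℤ) → sum t ≡ t x
sum-single t zero    z =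
  trans (cong (ℤ._+_ (t zero)) (sum-zero (λ j → t (suc j)) (λ j → z (suc j) λ ()))) (ℤ.+-identityʳ (t zero))
sum-single t (suc x) z =
  trans (cong₂ ℤ._+_ (z zero λ ()) (sum-single (λ j → t (suc j)) x (λ j ne → z (suc j) λ { refl → ne refl })))
        (ℤ.+-identityˡ (t (suc x)))

pos : ℤ → ℕ
pos (+ n)    = n
pos -[1+ _ ] = 0

module Laurent {N : Set} {_⊕_ : N → N → N} {𝟘 : N} {⊖_ : N → N}
  (isAbelianGroup : IsAbelianGroup _≡_ _⊕_ 𝟘 ⊖_) where

  open IsAbelianGroup isAbelianGroup using (assoc; comm; identityʳ; inverseˡ; inverseʳ)

  abelianGroup : AbelianGroup _ _
  abelianGroup = record { isAbelianGroup = isAbelianGroup }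

  open import Algebra.Properties.Monoid.Mult (AbelianGroup.monoid abelianGroup) using () renaming (_×_ to _·_)
  open import Algebra.Properties.CommutativeSemigroup (AbelianGroup.commutativeSemigroup abelianGroup)
    using (xy∙z≈xz∙y)

  Test : Set
  Test = N → Bool

  -- Δ x p is dual to multiplication by (1 + Tˣ)ᵖ.
  Δ : N → ℕ → Test → Test
  Δ x zero    h u = h u
  Δ x (suc p) h u = Δ x p h u xor Δ x p h (u ⊕ x)

  Δ-cong : ∀ x p {h h′} → h ≗ h′ → Δ x p h ≗ Δ x p h′
  Δ-cong x zero    e u = e u
  Δ-cong x (suc p) e u = cong₂ _xor_ (Δ-cong x p e u) (Δ-cong x p e (u ⊕ x))

  Δ-xor : ∀ x p h h′ u → Δ x p (λ v → h v xor h′ v) u ≡ Δ x p h u xor Δ x p h′ u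
  Δ-xor x zero    h h′ u = refl
  Δ-xor x (suc p) h h′ u =
    trans (cong₂ _xor_ (Δ-xor x p h h′ u) (Δ-xor x p h h′ (u ⊕ x))) (Xor.interchange (Δ x p h u) _ _ _)

  Δ-shift : ∀ x p h y u → Δ x p (λ v → h (v ⊕ y)) u ≡ Δ x p h (u ⊕ y)
  Δ-shift x zero    h y u = refl
  Δ-shift x (suc p) h y u =
    cong₂ _xor_ (Δ-shift x p h y u) (trans (Δ-shift x p h y (u ⊕ x)) (cong (Δ x p h) (xy∙z≈xz∙y u x y)))

  Δ-+ : ∀ x p q h u → Δ x (p ℕ.+ q) h u ≡ Δ x p (Δ x q h) u
  Δ-+ x zero    q h u = refl
  Δ-+ x (suc p) q h u = cong₂ _xor_ (Δ-+ x p q h u) (Δ-+ x p q h (u ⊕ x))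

  Δ-suc : ∀ x p h u → Δ x (suc p) h u ≡ Δ x p (Δ x 1 h) u
  Δ-suc x p h u = sym (trans (Δ-xor x p h (λ v → h (v ⊕ x)) u) (cong (Δ x p h u xor_) (Δ-shift x p h x u)))

  Δ-neg : ∀ x p h u → Δ x p h u ≡ Δ (⊖ x) p h (u ⊕ (p · x))
  Δ-neg x zero    h u = cong h (sym (identityʳ u))
  Δ-neg x (suc p) h u = begin
    Δ x p h u xor Δ x p h (u ⊕ x)
      ≡⟨ cong₂ _xor_ (Δ-neg x p h u) (Δ-neg x p h (u ⊕ x)) ⟩
    Δ (⊖ x) p h (u ⊕ (p · x)) xor Δ (⊖ x) p h ((u ⊕ x) ⊕ (p · x))
      ≡⟨ xor-comm (Δ (⊖ x) p h (u ⊕ (p · x))) _ ⟩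
    Δ (⊖ x) p h ((u ⊕ x) ⊕ (p · x)) xor Δ (⊖ x) p h (u ⊕ (p · x))
      ≡⟨ cong₂ _xor_ (cong (Δ (⊖ x) p h) (assoc u x (p · x))) (cong (Δ (⊖ x) p h) e) ⟩
    Δ (⊖ x) p h (u ⊕ (suc p · x)) xor Δ (⊖ x) p h ((u ⊕ (suc p · x)) ⊕ (⊖ x)) ∎
    where
    open ≡-Reasoning
    e : u ⊕ (p · x) ≡ (u ⊕ (suc p · x)) ⊕ (⊖ x)
    e = sym (begin
      (u ⊕ (x ⊕ (p · x))) ⊕ (⊖ x)   ≡⟨ cong (λ v → (u ⊕ v) ⊕ (⊖ x)) (comm x (p · x)) ⟩
      (u ⊕ ((p · x) ⊕ x)) ⊕ (⊖ x)   ≡⟨ cong (_⊕ (⊖ x)) (assoc u (p · x) x) ⟨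
      ((u ⊕ (p · x)) ⊕ x) ⊕ (⊖ x)   ≡⟨ assoc (u ⊕ (p · x)) x (⊖ x) ⟩
      (u ⊕ (p · x)) ⊕ (x ⊕ (⊖ x))   ≡⟨ cong ((u ⊕ (p · x)) ⊕_) (inverseʳ x) ⟩
      (u ⊕ (p · x)) ⊕ 𝟘             ≡⟨ identityʳ _ ⟩
      u ⊕ (p · x) ∎)

  double : ℕ → N → N
  double zero    x = x
  double (suc a) x = double a (x ⊕ x)

  Δ-double : ∀ x p h u → Δ x (p ℕ.+ p) h u ≡ Δ (x ⊕ x) p h u
  Δ-double x zero    h u = refl
  Δ-double x (suc p) h u = begin
    Δ x (suc (p ℕ.+ suc p)) h u             ≡⟨ cong (λ k → Δ x (suc k) h u) (ℕ.+-suc p p) ⟩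
    (D u xor D (u ⊕ x)) xor (D (u ⊕ x) xor D ((u ⊕ x) ⊕ x))
      ≡⟨ lem (D u) (D (u ⊕ x)) _ ⟩
    D u xor D ((u ⊕ x) ⊕ x)                 ≡⟨ cong₂ _xor_ (Δ-double x p h u)
                                                 (trans (Δ-double x p h _) (cong (Δ (x ⊕ x) p h) (assoc u x x))) ⟩
    Δ (x ⊕ x) p h u xor Δ (x ⊕ x) p h (u ⊕ (x ⊕ x)) ∎
    where
    open ≡-Reasoning
    D = Δ x (p ℕ.+ p) h
    lem : ∀ a b c → (a xor b) xor (b xor c) ≡ a xor c
    lem false false c = refl
    lem false true  false = refl
    lem false true  true  = refl
    lem true  false c = refl
    lem true  true  false = refl
    lem true  true  true  = refl

  Δ-2^ : ∀ a x h u → Δ x (2 ℕ.^ a) h u ≡ h u xor h (u ⊕ double a x)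
  Δ-2^ zero    x h u = refl
  Δ-2^ (suc a) x h u = begin
    Δ x (2 ℕ.^ suc a) h u               ≡⟨ cong (λ k → Δ x (2 ℕ.^ a ℕ.+ k) h u) (ℕ.+-identityʳ (2 ℕ.^ a)) ⟩
    Δ x (2 ℕ.^ a ℕ.+ 2 ℕ.^ a) h u       ≡⟨ Δ-double x (2 ℕ.^ a) h u ⟩
    Δ (x ⊕ x) (2 ℕ.^ a) h u             ≡⟨ Δ-2^ a (x ⊕ x) h u ⟩
    h u xor h (u ⊕ double (suc a) x)    ∎
    where open ≡-Reasoning

  expand : N → N → ℕ → List N
  expand x u zero    = u ∷ []
  expand x u (suc p) = expand x u p ++ expand x (u ⊕ x) p

  ∑-expand : ∀ x u p h → ∑ (expand x u p) h ≡ Δ x p h u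
  ∑-expand x u zero    h = xor-identityʳ (h u)
  ∑-expand x u (suc p) h =
    trans (∑-++ h (expand x u p) _) (cong₂ _xor_ (∑-expand x u p h) (∑-expand x (u ⊕ x) p h))

  record Graded (δ : N → ℤ) (v : N) (m : ℤ) : Set where
    constructor graded
    field shift : ∀ u → δ (u ⊕ v) ≡ δ u ℤ.+ m

  open Graded

  graded-⊕ : ∀ {δ v w l m} → Graded δ v l → Graded δ w m → Graded δ (v ⊕ w) (l ℤ.+ m)
  graded-⊕ {δ} {v} {w} {l} {m} g g′ .shift u = begin
    δ (u ⊕ (v ⊕ w))       ≡⟨ cong δ (assoc u v w) ⟨
    δ ((u ⊕ v) ⊕ w)       ≡⟨ shift g′ (u ⊕ v) ⟩
    δ (u ⊕ v) ℤ.+ m       ≡⟨ cong (ℤ._+ m) (shift g u) ⟩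
    δ u ℤ.+ l ℤ.+ m       ≡⟨ ℤ.+-assoc (δ u) l m ⟩
    δ u ℤ.+ (l ℤ.+ m)     ∎
    where open ≡-Reasoning

  graded-≡ : ∀ {δ v l m} → l ≡ m → Graded δ v l → Graded δ v m
  graded-≡ refl g = g

  graded-𝟘 : ∀ {δ} → Graded δ 𝟘 0ℤ
  graded-𝟘 {δ} .shift u = trans (cong δ (identityʳ u)) (sym (ℤ.+-identityʳ (δ u)))

  graded-· : ∀ {δ v m} → Graded δ v m → ∀ k → Graded δ (k · v) (+ k ℤ.* m)
  graded-·         g zero    = graded-𝟘
  graded-· {m = m} g (suc k) = graded-≡ (lem m (+ k)) (graded-⊕ g (graded-· g k))
    where
    lem : ∀ m k → m ℤ.+ k ℤ.* m ≡ (1ℤ ℤ.+ k) ℤ.* m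
    lem = solve-∀

  graded-double : ∀ a {δ v m} → Graded δ v m → Graded δ (double a v) (+ (2 ℕ.^ a) ℤ.* m)
  graded-double zero    {m = m} g = graded-≡ (sym (ℤ.*-identityˡ m)) g
  graded-double (suc a) {m = m} g = graded-≡ (lem (+ (2 ℕ.^ a)) m) (graded-double a (graded-⊕ g g))
    where
    lem : ∀ P m → P ℤ.* (m ℤ.+ m) ≡ (P ℤ.+ (P ℤ.+ 0ℤ)) ℤ.* m
    lem = solve-∀

  -- Polynomials that are sums of Tᵘ (1 + Tʸ)ᵖ with δ u + p ≥ s. For s = 0 and δ the exponent of a cluster
  -- variable z with mutation binomial 1 + Tʸ, these are the elements that stay Laurent after mutation at z.
  record Span (δ : N → ℤ) (y : N) (s : ℤ) (φ : Test → Bool) : Set where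
    constructor span
    field
      terms : List (N × ℕ)
      bound : All (λ (u , p) → s ℤ.≤ δ u ℤ.+ + p) terms
      value : ∀ h → φ h ≡ ∑ terms (λ (u , p) → Δ y p h u)

  module _ {δ : N → ℤ} {y : N} where

    span-resp : ∀ {s φ ψ} → (∀ h → ψ h ≡ φ h) → Span δ y s φ → Span δ y s ψ
    span-resp e (span L bd rep) = span L bd λ h → trans (e h) (rep h)

    span-weaken : ∀ {s s′ φ} → s′ ℤ.≤ s → Span δ y s φ → Span δ y s′ φ
    span-weaken le (span L bd rep) = span L (All.map (ℤ.≤-trans le) bd) rep

    span-false : ∀ {s} → Span δ y s (λ _ → false)
    span-false = span [] [] λ _ → refl

    span-xor : ∀ {s φ ψ} → Span δ y s φ → Span δ y s ψ → Span δ y s (λ h → φ h xor ψ h)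
    span-xor (span L bd rep) (span L′ bd′ rep′) =
      span (L ++ L′) (++⁺ bd bd′) λ h → trans (cong₂ _xor_ (rep h) (rep′ h)) (sym (∑-++ _ L L′))

    span-∑ : ∀ {s} {φ : A → Test → Bool} (as : List A) → All (λ a → Span δ y s (φ a)) as →
             Span δ y s (λ h → ∑ as (λ a → φ a h))
    span-∑ []       []       = span-false
    span-∑ (a ∷ as) (r ∷ rs) = span-xor r (span-∑ as rs)

    span-point : ∀ {s} u → s ℤ.≤ δ u → Span δ y s (λ h → h u)
    span-point u le =
      span ((u , 0) ∷ []) (subst (_ ℤ.≤_) (sym (ℤ.+-identityʳ (δ u))) le ∷ []) λ h → sym (xor-identityʳ (h u))

    span-cong : ∀ {s φ} → Span δ y s φ → ∀ {h h′} → h ≗ h′ → φ h ≡ φ h′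
    span-cong (span L _ rep) {h} {h′} e =
      trans (rep h) (trans (∑-cong-≗ L (λ (u , p) → Δ-cong y p e u)) (sym (rep h′)))

    span-additive : ∀ {s φ} → Span δ y s φ → ∀ h h′ → φ (λ v → h v xor h′ v) ≡ φ h xor φ h′
    span-additive {φ = φ} (span L _ rep) h h′ = begin
      φ (λ v → h v xor h′ v)
        ≡⟨ rep _ ⟩
      ∑ L (λ (u , p) → Δ y p (λ v → h v xor h′ v) u)
        ≡⟨ ∑-cong-≗ L (λ (u , p) → Δ-xor y p h h′ u) ⟩
      ∑ L (λ (u , p) → Δ y p h u xor Δ y p h′ u)
        ≡⟨ ∑-xor _ _ L ⟩
      ∑ L (λ (u , p) → Δ y p h u) xor ∑ L (λ (u , p) → Δ y p h′ u)
        ≡⟨ cong₂ _xor_ (rep h) (rep h′) ⟨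
      φ h xor φ h′ ∎
      where open ≡-Reasoning

    span-shift : ∀ {s φ v m} → Graded δ v m → Span δ y s φ → Span δ y (s ℤ.+ m) (λ h → φ (λ w → h (w ⊕ v)))
    span-shift {s} {φ} {v} {m} g (span L bd rep) =
      span (map (λ (u , p) → u ⊕ v , p) L)
      (map⁺ (All.map (λ {(u , p)} le → subst (s ℤ.+ m ℤ.≤_)
        (trans (lem (δ u) (+ p) m) (cong (ℤ._+ + p) (sym (shift g u)))) (ℤ.+-monoˡ-≤ m le)) bd))
      λ h → trans (rep _) (trans (∑-cong-≗ L (λ (u , p) → Δ-shift y p h v u)) (sym (∑-map _ _ L)))
      where
      lem : ∀ a p m → a ℤ.+ p ℤ.+ m ≡ a ℤ.+ m ℤ.+ p
      lem = solve-∀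

    span-Δ-self : ∀ {s φ} → Span δ y s φ → Span δ y (s ℤ.+ 1ℤ) (λ h → φ (Δ y 1 h))
    span-Δ-self {s} (span L bd rep) =
      span (map (λ (u , p) → u , suc p) L)
      (map⁺ (All.map (λ {(u , p)} le → subst (s ℤ.+ 1ℤ ℤ.≤_) (lem (δ u) (+ p)) (ℤ.+-monoˡ-≤ 1ℤ le)) bd))
      λ h → trans (rep _) (trans (∑-cong-≗ L (λ (u , p) → sym (Δ-suc y p h u))) (sym (∑-map _ _ L)))
      where
      lem : ∀ a p → a ℤ.+ p ℤ.+ 1ℤ ≡ a ℤ.+ (1ℤ ℤ.+ p)
      lem = solve-∀

    module _ {z : N} {m : ℕ} (g : Graded δ z (+ m)) where

      span-shift-≤ : ∀ {s φ} → Span δ y s φ → Span δ y s (λ h → φ (λ w → h (w ⊕ z)))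
      span-shift-≤ {s} r = span-weaken (ℤ.i≤i+j s (+ m)) (span-shift g r)

      span-Δ : ∀ {s φ} p → Span δ y s φ → Span δ y s (λ h → φ (Δ z p h))
      span-Δ zero    r = r
      span-Δ (suc p) r =
        span-resp (λ h → span-additive r _ _) (span-xor (span-Δ p r) (span-Δ p (span-shift-≤ r)))

      span-Δ-1 : ∀ {s φ} p → 1 ℕ.≤ m → Span δ y s φ → Span δ y (s ℤ.+ 1ℤ) (λ h → φ (λ v → Δ z p h v xor h v))
      span-Δ-1 {s} {φ} zero    1≤m r = span-resp (λ h → trans (span-additive r h h) (xor-same (φ h))) span-false
      span-Δ-1 {s} {φ} (suc p) 1≤m r =
        span-resp (λ h → trans (span-cong r (λ v → lem (Δ z p h v) _ (h v))) (span-additive r _ _))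
          (span-xor (span-Δ-1 p 1≤m r)
                    (span-Δ p (span-weaken (ℤ.+-monoʳ-≤ s (ℤ.+≤+ 1≤m)) (span-shift g r))))
        where
        lem : ∀ a b c → (a xor b) xor c ≡ (a xor c) xor b
        lem = Xor.xy∙z≈xz∙y

    span-Δ-1′ : ∀ {z m s φ} → Graded δ z (+ m) → Span δ y s φ →
                Span δ y (s ℤ.+ 1ℤ) (λ h → φ (λ v → Δ z m h v xor h v))
    span-Δ-1′ {m = zero} {φ = φ} g r = span-resp (λ h → trans (span-additive r h h) (xor-same (φ h))) span-false
    span-Δ-1′ {m = suc m} g r = span-Δ-1 g (suc m) (ℕ.s≤s ℕ.z≤n) r

    span-E⁻ : ∀ {z m s φ} → Graded δ z (+ m) → Span δ y s φ →
              Span δ y (s ℤ.+ 1ℤ) (λ h → φ (λ v → Δ z m h v xor h (v ⊕ y)))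
    span-E⁻ {z} {m} {s} {φ} g r =
      span-resp (λ h → trans (span-cong r (λ v → lem (Δ z m h v) (h v) (h (v ⊕ y)))) (span-additive r _ _))
        (span-xor (span-Δ-1′ g r) (span-Δ-self r))
      where
      lem : ∀ a b c → a xor c ≡ (a xor b) xor (b xor c)
      lem a b c = sym (trans (xor-assoc a b (b xor c))
        (cong (a xor_) (trans (sym (xor-assoc b b c)) (cong (_xor c) (xor-same b)))))

    span-E⁺ : ∀ {z m s φ} → Graded δ z (+ m) → Graded δ y 0ℤ → Span δ y s φ →
              Span δ y (s ℤ.+ 1ℤ) (λ h → φ (λ v → h v xor Δ z m h (v ⊕ y)))
    span-E⁺ {z} {m} {s} {φ} g g₀ r =
      span-resp (λ h → trans (span-cong r (λ v → lem (h v) (h (v ⊕ y)) (Δ z m h (v ⊕ y)))) (span-additive r _ _))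
        (span-xor (span-Δ-self r)
                  (span-Δ-1′ g (span-weaken (ℤ.≤-reflexive (sym (ℤ.+-identityʳ s))) (span-shift g₀ r))))
      where
      lem : ∀ a b c → a xor c ≡ (a xor b) xor (c xor b)
      lem a b c = sym (trans (xor-assoc a b (c xor b))
        (cong (a xor_) (trans (cong (b xor_) (xor-comm c b))
          (trans (sym (xor-assoc b b c)) (cong (_xor c) (xor-same b))))))

  iter : (Test → Test) → ℕ → Test → Test
  iter E zero    h = h
  iter E (suc r) h = E (iter E r h)

  span-iter : ∀ {δ y s φ} (E : Test → Test) →
              (∀ {s φ} → Span δ y s φ → Span δ y (s ℤ.+ 1ℤ) (λ h → φ (E h))) →
              ∀ r → Span δ y s φ → Span δ y (s ℤ.+ + r) (λ h → φ (iter E r h))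
  span-iter {δ} {y} {s} E step zero    R = span-weaken {δ} {y} (ℤ.≤-reflexive (ℤ.+-identityʳ s)) R
  span-iter {δ} {y} {s} E step (suc r) R =
    span-weaken {δ} {y} (ℤ.≤-reflexive (sym (ℤ.+-assoc s 1ℤ (+ r)))) (span-iter {δ} {y} E step r (step R))

  module _ (δ : N → ℤ) (x : N) where

    -- Dual to multiplying the component of degree d by (1 + Tˣ)^(K + d); the shift by K makes the
    -- exponents nonnegative where it is used (∣_∣ returns junk elsewhere).
    scale : ℕ → Test → Test
    scale K h u = Δ x ∣ + K ℤ.+ δ u ∣ h u

    scale-≡ : ∀ {K h u k} → + k ≡ + K ℤ.+ δ u → scale K h u ≡ Δ x k h u
    scale-≡ {K} {h} {u} e = cong (λ z → Δ x ∣ z ∣ h u) (sym e)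

    Δ-scale : Graded δ x 0ℤ → ∀ {K h} p u {k} → + k ≡ + K ℤ.+ δ u → Δ x p (scale K h) u ≡ Δ x (p ℕ.+ k) h u
    Δ-scale g zero    u e = scale-≡ e
    Δ-scale g {K} (suc p) u e =
      cong₂ _xor_ (Δ-scale g p u e)
        (Δ-scale g p (u ⊕ x) (trans e (cong (ℤ._+_ (+ K)) (sym (trans (shift g u) (ℤ.+-identityʳ (δ u)))))))

    Δ-scale⁺ : ∀ {y m K h} → Graded δ y (+ m) → ∀ r w {k} → + k ≡ + K ℤ.+ δ w →
               Δ y r (scale K h) w ≡ Δ x k (iter (λ f v → f v xor Δ x m f (v ⊕ y)) r h) w
    Δ-scale⁺ g zero w e = scale-≡ e
    Δ-scale⁺ {y} {m} {K} {h} g (suc r) w {k} e = begin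
      Δ y r (scale K h) w xor Δ y r (scale K h) (w ⊕ y)
        ≡⟨ cong₂ _xor_ (Δ-scale⁺ g r w e) (Δ-scale⁺ g r (w ⊕ y) e′) ⟩
      Δ x k f w xor Δ x (k ℕ.+ m) f (w ⊕ y)
        ≡⟨ cong (Δ x k f w xor_) (trans (Δ-+ x k m f (w ⊕ y)) (sym (Δ-shift x k (Δ x m f) y w))) ⟩
      Δ x k f w xor Δ x k (λ v → Δ x m f (v ⊕ y)) w
        ≡⟨ Δ-xor x k f _ w ⟨
      Δ x k (λ v → f v xor Δ x m f (v ⊕ y)) w ∎
      where
      open ≡-Reasoning
      f = iter (λ f v → f v xor Δ x m f (v ⊕ y)) r h
      e′ : + (k ℕ.+ m) ≡ + K ℤ.+ δ (w ⊕ y)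
      e′ = trans (cong (ℤ._+ + m) e) (trans (ℤ.+-assoc (+ K) (δ w) (+ m)) (cong (ℤ._+_ (+ K)) (sym (shift g w))))

    Δ-scale⁻ : ∀ {y m K h} → Graded δ y (ℤ.- + m) → ∀ r w {k} → + (k ℕ.+ r ℕ.* m) ≡ + K ℤ.+ δ w →
               Δ y r (scale K h) w ≡ Δ x k (iter (λ f v → Δ x m f v xor f (v ⊕ y)) r h) w
    Δ-scale⁻ g zero w {k} e = scale-≡ (trans (cong +_ (sym (ℕ.+-identityʳ k))) e)
    Δ-scale⁻ {y} {m} {K} {h} g (suc r) w {k} e = begin
      Δ y r (scale K h) w xor Δ y r (scale K h) (w ⊕ y)
        ≡⟨ cong₂ _xor_ (Δ-scale⁻ g r w e₁) (Δ-scale⁻ g r (w ⊕ y) e₂) ⟩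
      Δ x (k ℕ.+ m) f w xor Δ x k f (w ⊕ y)
        ≡⟨ cong₂ _xor_ (Δ-+ x k m f w) (sym (Δ-shift x k f y w)) ⟩
      Δ x k (Δ x m f) w xor Δ x k (λ v → f (v ⊕ y)) w
        ≡⟨ Δ-xor x k _ _ w ⟨
      Δ x k (λ v → Δ x m f v xor f (v ⊕ y)) w ∎
      where
      open ≡-Reasoning
      f = iter (λ f v → Δ x m f v xor f (v ⊕ y)) r h
      e₁ : + (k ℕ.+ m ℕ.+ r ℕ.* m) ≡ + K ℤ.+ δ w
      e₁ = trans (cong +_ (ℕ.+-assoc k m (r ℕ.* m))) e
      lem : ∀ a m → a ≡ a ℤ.+ m ℤ.+ ℤ.- m
      lem = solve-∀
      lem₂ : ∀ k m r → k ℤ.+ r ≡ k ℤ.+ (m ℤ.+ r) ℤ.+ ℤ.- m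
      lem₂ = solve-∀
      e₂ : + (k ℕ.+ r ℕ.* m) ≡ + K ℤ.+ δ (w ⊕ y)
      e₂ = begin
        + (k ℕ.+ r ℕ.* m)                         ≡⟨ lem₂ (+ k) (+ m) (+ (r ℕ.* m)) ⟩
        + (k ℕ.+ suc r ℕ.* m) ℤ.+ ℤ.- + m         ≡⟨ cong (ℤ._+ ℤ.- + m) e ⟩
        + K ℤ.+ δ w ℤ.+ ℤ.- + m                   ≡⟨ ℤ.+-assoc (+ K) (δ w) (ℤ.- + m) ⟩
        + K ℤ.+ (δ w ℤ.+ ℤ.- + m)                 ≡⟨ cong (ℤ._+_ (+ K)) (shift g w) ⟨
        + K ℤ.+ δ (w ⊕ y)                         ∎

    -- W′ is obtained from W by multiplying the component of degree d by (1 + Tˣ)^d.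
    record Crossing (W W′ : List N) : Set where
      field
        terms  : List (N × ℕ)
        bound  : All (λ (u , p) → 0ℤ ℤ.≤ δ u ℤ.+ + p) terms
        before : ∀ h → ∑ W h  ≡ ∑ terms (λ (u , p) → Δ x p h u)
        after  : ∀ h → ∑ W′ h ≡ ∑ terms (λ (u , p) → Δ x ∣ δ u ℤ.+ + p ∣ h u)

    ∃-crossing : ∀ {W} → Span δ x 0ℤ (∑ W) → ∃ λ W′ → Crossing W W′
    ∃-crossing (span L bd rep) = concatMap (λ (u , p) → expand x u ∣ δ u ℤ.+ + p ∣) L , record
      { terms  = L
      ; bound  = bd
      ; before = rep
      ; after  = λ h → trans (∑-concatMap h _ L) (∑-cong-≗ L (λ (u , p) → ∑-expand x u ∣ δ u ℤ.+ + p ∣ h))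
      }

    module _ {W W′ : List N} (cr : Crossing W W′) where
      open Crossing cr

      ∑-scale : Graded δ x 0ℤ → ∃ λ K₀ → ∀ K → K₀ ℕ.≤ K → ∀ h → ∑ W (scale K h) ≡ ∑ W′ (Δ x K h)
      ∑-scale g = K₀ , λ K le h → begin
        ∑ W (scale K h)                                                 ≡⟨ before (scale K h) ⟩
        ∑ terms (λ (u , p) → Δ x p (scale K h) u)
          ≡⟨ ∑-cong terms (All.zipWith (λ {(u , p)} (b , p≤K) → term K h u p b p≤K) (bound , bnd K le)) ⟩
        ∑ terms (λ (u , p) → Δ x ∣ δ u ℤ.+ + p ∣ (Δ x K h) u)           ≡⟨ after (Δ x K h) ⟨
        ∑ W′ (Δ x K h)                                                  ∎
        where
        open ≡-Reasoning
        K₀ = proj₁ (eventually-bounded proj₂ terms)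
        bnd = proj₂ (eventually-bounded proj₂ terms)
        lem : ∀ j d p → j ℤ.+ (d ℤ.+ p) ≡ p ℤ.+ j ℤ.+ d
        lem = solve-∀
        term : ∀ K h u p → 0ℤ ℤ.≤ δ u ℤ.+ + p → p ℕ.≤ K →
               Δ x p (scale K h) u ≡ Δ x ∣ δ u ℤ.+ + p ∣ (Δ x K h) u
        term K h u p b p≤K with ℕ.m≤n⇒∃[o]m+o≡n p≤K
        ... | j , refl = begin
          Δ x p (scale (p ℕ.+ j) h) u             ≡⟨ Δ-scale g p u e ⟩
          Δ x (p ℕ.+ (j ℕ.+ q)) h u               ≡⟨ cong (λ k → Δ x k h u)
                                                       (trans (sym (ℕ.+-assoc p j q)) (ℕ.+-comm (p ℕ.+ j) q)) ⟩
          Δ x (q ℕ.+ (p ℕ.+ j)) h u               ≡⟨ Δ-+ x q (p ℕ.+ j) h u ⟩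
          Δ x q (Δ x (p ℕ.+ j) h) u               ∎
          where
          q = ∣ δ u ℤ.+ + p ∣
          e : + (j ℕ.+ q) ≡ + (p ℕ.+ j) ℤ.+ δ u
          e = trans (cong (ℤ._+_ (+ j)) (ℤ.0≤i⇒+∣i∣≡i b)) (lem (+ j) (δ u) (+ p))

      span-reverse : ∀ {δ′} → Graded δ x 0ℤ → (∀ u → δ′ u ≡ ℤ.- δ u) → Span δ′ (⊖ x) 0ℤ (∑ W′)
      span-reverse {δ′} g neg =
        span (map (λ (u , p) → u ⊕ (q u p · x) , q u p) terms)
        (map⁺ (All.map (λ {(u , p)} b → subst (0ℤ ℤ.≤_) (sym (degree u p b)) (ℤ.+≤+ ℕ.z≤n)) bound))
        λ h → trans (after h) (trans (∑-cong-≗ terms (λ (u , p) → Δ-neg x (q u p) h u)) (sym (∑-map _ _ terms)))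
        where
        open ≡-Reasoning
        q : N → ℕ → ℕ
        q u p = ∣ δ u ℤ.+ + p ∣
        lem : ∀ d p q → ℤ.- (d ℤ.+ q ℤ.* 0ℤ) ℤ.+ (d ℤ.+ p) ≡ p
        lem = solve-∀
        degree : ∀ u p → 0ℤ ℤ.≤ δ u ℤ.+ + p → δ′ (u ⊕ (q u p · x)) ℤ.+ + q u p ≡ + p
        degree u p b = begin
          δ′ (u ⊕ (q u p · x)) ℤ.+ + q u p
            ≡⟨ cong₂ ℤ._+_ (trans (neg _) (cong ℤ.-_ (shift (graded-· g (q u p)) u))) (ℤ.0≤i⇒+∣i∣≡i b) ⟩
          ℤ.- (δ u ℤ.+ + q u p ℤ.* 0ℤ) ℤ.+ (δ u ℤ.+ + p)
            ≡⟨ lem (δ u) (+ p) (+ q u p) ⟩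
          + p ∎

  open import Algebra.Properties.Group (AbelianGroup.group abelianGroup) using (⁻¹-involutive)

  graded-⊖ : ∀ {δ v m} → Graded δ v m → Graded δ (⊖ v) (ℤ.- m)
  graded-⊖ {δ} {v} {m} g .shift u = begin
    δ (u ⊕ (⊖ v))                       ≡⟨ lem (δ (u ⊕ (⊖ v))) m ⟩
    δ (u ⊕ (⊖ v)) ℤ.+ m ℤ.+ ℤ.- m       ≡⟨ cong (ℤ._+ ℤ.- m) (shift g (u ⊕ (⊖ v))) ⟨
    δ ((u ⊕ (⊖ v)) ⊕ v) ℤ.+ ℤ.- m       ≡⟨ cong (λ w → δ w ℤ.+ ℤ.- m) (trans (assoc u (⊖ v) v)
                                             (trans (cong (u ⊕_) (inverseˡ v)) (identityʳ u))) ⟩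
    δ u ℤ.+ ℤ.- m                       ∎
    where
    open ≡-Reasoning
    lem : ∀ a m → a ≡ a ℤ.+ m ℤ.+ ℤ.- m
    lem = solve-∀

  module _ {δ : N → ℤ} {x : N} {W W′ : List N} (cr : Crossing δ x W W′) (gx : Graded δ x 0ℤ)
           {δ′ : N → ℤ} {y : N} where

    -- Through scale, 1 + Tʸ becomes (1 + Tˣ)ᵐ + Tʸ up to a power of 1 + Tˣ, and this operator still raises
    -- the valuation by one: it is (1 + Tʸ) + ((1 + Tˣ)ᵐ + 1), and Tˣ has degree m.
    span-crossing⁻ : ∀ {m} → Graded δ′ x (+ m) → Graded δ y (ℤ.- + m) → Span δ′ y 0ℤ (∑ W) →
                     Eventually (λ K → Span δ′ y 0ℤ (λ h → ∑ W′ (Δ x K h)))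
    span-crossing⁻ {m} gx′ gy (span L bd rep) = K₁ ℕ.+ K₂ , λ K le →
      span-resp (λ h → trans (sym (scaled K (ℕ.m+n≤o⇒m≤o K₁ le) h)) (rep (scale δ x K h)))
        (span-∑ L (All.zipWith (λ {(w , r)} (b , K≥) → term K w r b K≥) (bd , bnd K (ℕ.m+n≤o⇒n≤o K₁ le))))
      where
      K₁ = proj₁ (∑-scale δ x cr gx)
      scaled = proj₂ (∑-scale δ x cr gx)
      K₂ = proj₁ (eventually-bounded (λ (w , r) → ∣ δ w ∣ ℕ.+ r ℕ.* m) L)
      bnd = proj₂ (eventually-bounded (λ (w , r) → ∣ δ w ∣ ℕ.+ r ℕ.* m) L)
      term : ∀ K w r → 0ℤ ℤ.≤ δ′ w ℤ.+ + r → ∣ δ w ∣ ℕ.+ r ℕ.* m ℕ.≤ K →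
             Span δ′ y 0ℤ (λ h → Δ y r (scale δ x K h) w)
      term K w r b K≥ with ∃-shifted (δ w) (r ℕ.* m) K K≥
      ... | k , e = span-resp (λ h → Δ-scale⁻ δ x gy r w e)
        (span-weaken b (span-iter _ (span-E⁻ gx′) r (span-Δ gx′ k (span-point w ℤ.≤-refl))))

    module _ {m : ℕ} {δ″ : N → ℤ} (sum : ∀ u → δ″ u ≡ δ′ u ℤ.+ + m ℤ.* δ u)
             (gx″ : Graded δ″ x (ℤ.- + m)) (gy : Graded δ y (+ m)) where

      private
        z = ⊖ x
        y″ = y ⊕ (m · x)
        E : Test → Test
        E f v = f v xor Δ x m f (v ⊕ y)

        gz : Graded δ″ z (+ m)
        gz = graded-≡ (ℤ.neg-involutive (+ m)) (graded-⊖ gx″)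

      span-crossing⁺ : Graded δ″ y″ 0ℤ → Span δ′ y 0ℤ (∑ W) →
                       Eventually (λ K → Span δ″ y″ 0ℤ (λ h → ∑ W′ (Δ z K h)))
      span-crossing⁺ gy″ (span L bd rep) = K₁ ℕ.+ K₂ , λ K le →
        let r = span-resp (λ h → trans (sym (scaled K (ℕ.m+n≤o⇒m≤o K₁ le) h)) (rep (scale δ x K h)))
                  (span-∑ L (All.zipWith (λ {(w , r)} (b , K≥) → term K w r b K≥) (bd , bnd K (ℕ.m+n≤o⇒n≤o K₁ le))))
        in span-resp (λ h → ∑-cong-≗ W′ (λ u → unshift K h u))
             (span-weaken (ℤ.≤-reflexive (sym (ℤ.+-inverseˡ (+ K ℤ.* + m)))) (span-shift (graded-· gz K) r))
        where
        K₁ = proj₁ (∑-scale δ x cr gx)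
        scaled = proj₂ (∑-scale δ x cr gx)
        K₂ = proj₁ (eventually-bounded (λ (w , r) → ∣ δ w ∣ ℕ.+ 0) L)
        bnd = proj₂ (eventually-bounded (λ (w , r) → ∣ δ w ∣ ℕ.+ 0) L)

        unshift : ∀ K h u → Δ z K h u ≡ Δ x K (λ w → h (w ⊕ (K · z))) u
        unshift K h u = trans (Δ-neg z K h u)
          (trans (cong (λ v → Δ v K h (u ⊕ (K · z))) (⁻¹-involutive x)) (sym (Δ-shift x K h (K · z) u)))

        span-E : ∀ {s φ} → Span δ″ y″ s φ → Span δ″ y″ (s ℤ.+ 1ℤ) (λ h → φ (E h))
        span-E r = span-resp (λ h → span-cong r (λ v → cong (h v xor_)
          (trans (Δ-neg x m h (v ⊕ y)) (cong (Δ z m h) (assoc v y (m · x)))))) (span-E⁺ gz gy″ r)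

        lem : ∀ d r m K δw → ℤ.- (K ℤ.* m) ℤ.+ (d ℤ.+ r) ≡ d ℤ.+ m ℤ.* δw ℤ.+ (K ℤ.+ δw) ℤ.* ℤ.- m ℤ.+ r
        lem = solve-∀

        term : ∀ K w r → 0ℤ ℤ.≤ δ′ w ℤ.+ + r → ∣ δ w ∣ ℕ.+ 0 ℕ.≤ K →
               Span δ″ y″ (ℤ.- (+ K ℤ.* + m)) (λ h → Δ y r (scale δ x K h) w)
        term K w r b K≥ with ∃-shifted (δ w) 0 K K≥
        ... | k , e = span-resp (λ h → Δ-scale⁺ δ x gy r w e′)
          (span-weaken bound
            (span-iter E span-E r
              (span-resp (λ h → Δ-neg x k h w) (span-Δ gz k (span-point (w ⊕ (k · x)) ℤ.≤-refl)))))
          where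
          e′ : + k ≡ + K ℤ.+ δ w
          e′ = trans (cong +_ (sym (ℕ.+-identityʳ k))) e
          bound : ℤ.- (+ K ℤ.* + m) ℤ.≤ δ″ (w ⊕ (k · x)) ℤ.+ + r
          bound = begin
            ℤ.- (+ K ℤ.* + m)
              ≡⟨ ℤ.+-identityʳ _ ⟨
            ℤ.- (+ K ℤ.* + m) ℤ.+ 0ℤ
              ≤⟨ ℤ.+-monoʳ-≤ (ℤ.- (+ K ℤ.* + m)) b ⟩
            ℤ.- (+ K ℤ.* + m) ℤ.+ (δ′ w ℤ.+ + r)
              ≡⟨ lem (δ′ w) (+ r) (+ m) (+ K) (δ w) ⟩
            δ′ w ℤ.+ + m ℤ.* δ w ℤ.+ (+ K ℤ.+ δ w) ℤ.* ℤ.- + m ℤ.+ + r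
              ≡⟨ cong₂ (λ a c → a ℤ.+ c ℤ.* ℤ.- + m ℤ.+ + r) (sum w) e′ ⟨
            δ″ w ℤ.+ + k ℤ.* ℤ.- + m ℤ.+ + r
              ≡⟨ cong (ℤ._+ + r) (shift (graded-· gx″ k) w) ⟨
            δ″ (w ⊕ (k · x)) ℤ.+ + r ∎
            where open ℤ.≤-Reasoning

  ∑-2^ : ∀ (W : List N) a x h → ∑ W (Δ x (2 ℕ.^ a) h) ≡ ∑ W h xor ∑ W (λ u → h (u ⊕ double a x))
  ∑-2^ W a x h = trans (∑-cong-≗ W (Δ-2^ a x h)) (∑-xor _ _ W)

  ∑-2^′ : ∀ (W : List N) a x h → ∑ W h ≡ ∑ W (Δ x (2 ℕ.^ a) h) xor ∑ W (λ u → h (u ⊕ double a x))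
  ∑-2^′ W a x h = sym (begin
    ∑ W (Δ x (2 ℕ.^ a) h) xor s       ≡⟨ cong (_xor s) (∑-2^ W a x h) ⟩
    (∑ W h xor s) xor s               ≡⟨ xor-assoc (∑ W h) s s ⟩
    ∑ W h xor (s xor s)               ≡⟨ cong (∑ W h xor_) (xor-same s) ⟩
    ∑ W h xor false                   ≡⟨ xor-identityʳ _ ⟩
    ∑ W h                             ∎)
    where
    open ≡-Reasoning
    s = ∑ W (λ u → h (u ⊕ double a x))

  module _ {δ : N → ℤ} {y z : N} {W : List N} where

    -- In characteristic 2, (1 + Tᶻ)^(2^a) = 1 + T^(2^a z), and T^(2^a z) W has nonnegative degree for large a.
    span-reflect : ∀ {m} → Graded δ z (+ suc m) →
                   Eventually (λ K → Span δ y 0ℤ (λ h → ∑ W (Δ z K h))) → Span δ y 0ℤ (∑ W)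
    span-reflect {m} g (K₀ , ev) =
      span-resp (∑-2^′ W a z)
        (span-xor (ev (2 ℕ.^ a) (ℕ.≤-trans (ℕ.m≤m+n K₀ K₁) (n≤2^n a)))
          (span-∑ W (All.map (λ {u} le → span-point (u ⊕ double a z)
              (subst (0ℤ ℤ.≤_) (sym (shift (graded-double a g) u)) (0≤i+2^a*j (δ u) a m le)))
            (bnd a (ℕ.m≤n+m K₁ K₀)))))
      where
      K₁ = proj₁ (eventually-bounded (λ u → ∣ δ u ∣) W)
      bnd = proj₂ (eventually-bounded (λ u → ∣ δ u ∣) W)
      a = K₀ ℕ.+ K₁

    span-term : ∀ {s} u p → s ℤ.≤ δ u ℤ.+ + p → Span δ y s (λ h → Δ y p h u)
    span-term u p le = span ((u , p) ∷ []) (le ∷ []) λ h → sym (xor-identityʳ _)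

    -- When the translation by z does not raise δ, the supports of W and of its translate by a large
    -- multiple of z are separated by a functional l that is constant along y.
    span-separate : ∀ {l} → Graded l y 0ℤ → Graded l z 1ℤ →
                    Eventually (λ K → Span δ y 0ℤ (λ h → ∑ W (Δ z K h))) → Span δ y 0ℤ (∑ W)
    span-separate {l} gy gz (K₀ , ev) =
      span-resp (λ h → trans (low h) (trans (value (below h)) (∑-cong-≗ terms (λ (u , p) → Δ-below u p h))))
        (span-∑ terms (All.map (λ {(u , p)} b → span-∧ ⌊ l u ℤ.≤? + K₁ ⌋ (span-term u p b)) bound))
      where
      open ≡-Reasoning
      K₁ = proj₁ (eventually-bounded (λ u → ∣ l u ∣) W)
      bnd = proj₂ (eventually-bounded (λ u → ∣ l u ∣) W) K₁ ℕ.≤-refl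
      a = K₀ ℕ.+ suc (K₁ ℕ.+ K₁)

      open Span (ev (2 ℕ.^ a) (ℕ.≤-trans (ℕ.m≤m+n K₀ _) (n≤2^n a)))

      below : Test → Test
      below h u = ⌊ l u ℤ.≤? + K₁ ⌋ ∧ h u

      span-∧ : ∀ b {s φ} → Span δ y s φ → Span δ y s (λ h → b ∧ φ h)
      span-∧ true  r = r
      span-∧ false r = span-false

      Δ-below : ∀ u p h → Δ y p (below h) u ≡ ⌊ l u ℤ.≤? + K₁ ⌋ ∧ Δ y p h u
      Δ-below u zero    h = refl
      Δ-below u (suc p) h rewrite Δ-below u p h | Δ-below (u ⊕ y) p h | shift gy u | ℤ.+-identityʳ (l u)
        with ⌊ l u ℤ.≤? + K₁ ⌋
      ... | true  = refl
      ... | false = refl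

      inside : ∀ h {u} → ∣ l u ∣ ℕ.≤ K₁ → h u ≡ below h u
      inside h {u} le with l u ℤ.≤? + K₁
      ... | yes _ = refl
      ... | no ¬p = contradiction (ℤ.≤-trans (i≤∣i∣ (l u)) (ℤ.+≤+ le)) ¬p

      K₁<2^a : suc (K₁ ℕ.+ K₁) ℕ.≤ 2 ℕ.^ a
      K₁<2^a = ℕ.≤-trans (ℕ.m≤n+m _ K₀) (n≤2^n a)

      outside : ∀ h {u} → ∣ l u ∣ ℕ.≤ K₁ → below h (u ⊕ double a z) ≡ false
      outside h {u} le with l (u ⊕ double a z) ℤ.≤? + K₁
      ... | no _  = refl
      ... | yes p = contradiction p (ℤ.<⇒≱ (ℤ.<-≤-trans (ℤ.+<+ (ℕ.n<1+n K₁)) (≤R.begin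
        + suc K₁                                ≤R.≡⟨ lem (+ K₁) ⟩
        ℤ.- + K₁ ℤ.+ + suc (K₁ ℕ.+ K₁)          ≤R.≤⟨ ℤ.+-mono-≤ (ℤ.≤-trans (ℤ.neg-mono-≤ (ℤ.+≤+ le)) (-∣i∣≤i (l u)))
                                                        (ℤ.+≤+ K₁<2^a) ⟩
        l u ℤ.+ + (2 ℕ.^ a)                     ≤R.≡⟨ cong (ℤ._+_ (l u)) (ℤ.*-identityʳ (+ (2 ℕ.^ a))) ⟨
        l u ℤ.+ + (2 ℕ.^ a) ℤ.* 1ℤ              ≤R.≡⟨ shift (graded-double a gz) u ⟨
        l (u ⊕ double a z)                      ≤R.∎)))
        where
        module ≤R = ℤ.≤-Reasoning
        lem : ∀ k → 1ℤ ℤ.+ k ≡ ℤ.- k ℤ.+ (1ℤ ℤ.+ (k ℤ.+ k))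
        lem = solve-∀

      low : ∀ h → ∑ W h ≡ ∑ W (Δ z (2 ℕ.^ a) (below h))
      low h = begin
        ∑ W h                                                        ≡⟨ ∑-cong W (All.map (inside h) bnd) ⟩
        ∑ W (below h)                                                ≡⟨ xor-identityʳ _ ⟨
        ∑ W (below h) xor false                                      ≡⟨ cong (∑ W (below h) xor_)
                                                                          (∑-zero W (All.map (outside h) bnd)) ⟨
        ∑ W (below h) xor ∑ W (λ u → below h (u ⊕ double a z))       ≡⟨ ∑-2^ W a z (below h) ⟨
        ∑ W (Δ z (2 ℕ.^ a) (below h))                                ∎

  Leading : (N → ℤ) → List N → Set
  Leading l W = ∀ h → (∀ v → 0ℤ ℤ.< l v → h v ≡ false) → ∑ W h ≡ h 𝟘

  module _ {l : N → ℤ} (l𝟘 : l 𝟘 ≡ 0ℤ) where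

    leading-crossing : ∀ {δ x W W′ m} → Crossing δ x W W′ → Graded δ x 0ℤ → Graded l x (+ suc m) →
                       Leading l W → Leading l W′
    leading-crossing {δ} {x} {W} {W′} {m} cr g gl lead h vanish = begin
      ∑ W′ h
        ≡⟨ ∑-2^′ W′ a x h ⟩
      ∑ W′ (Δ x (2 ℕ.^ a) h) xor ∑ W′ (λ u → h (u ⊕ double a x))
        ≡⟨ cong₂ _xor_ (sym (scaled (2 ℕ.^ a) (ℕ.≤-trans (ℕ.m≤m+n K₀ _) (n≤2^n a)) h))
             (∑-zero W′ (All.map (λ {u} le → vanish _ (far u le)) bnd)) ⟩
      ∑ W (scale δ x (2 ℕ.^ a) h) xor false
        ≡⟨ xor-identityʳ _ ⟩
      ∑ W (scale δ x (2 ℕ.^ a) h)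
        ≡⟨ lead _ (λ v pos → Δ-vanish ∣ + (2 ℕ.^ a) ℤ.+ δ v ∣ v pos) ⟩
      scale δ x (2 ℕ.^ a) h 𝟘
        ≡⟨ Δ-head ∣ + (2 ℕ.^ a) ℤ.+ δ 𝟘 ∣ 𝟘 (ℤ.≤-reflexive (sym l𝟘)) ⟩
      h 𝟘 ∎
      where
      open ≡-Reasoning
      K₀ = proj₁ (∑-scale δ x cr g)
      scaled = proj₂ (∑-scale δ x cr g)
      K₁ = proj₁ (eventually-bounded (λ u → ∣ ℤ.- 1ℤ ℤ.+ l u ∣) W′)
      a = K₀ ℕ.+ K₁
      bnd = proj₂ (eventually-bounded (λ u → ∣ ℤ.- 1ℤ ℤ.+ l u ∣) W′) a (ℕ.m≤n+m K₁ K₀)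

      step : ∀ u → 0ℤ ℤ.≤ l u → 0ℤ ℤ.< l (u ⊕ x)
      step u le = subst (0ℤ ℤ.<_) (sym (shift gl u)) (ℤ.+-mono-≤-< le (ℤ.+<+ (ℕ.s≤s ℕ.z≤n)))

      Δ-vanish : ∀ p v → 0ℤ ℤ.< l v → Δ x p h v ≡ false
      Δ-vanish zero    v pos = vanish v pos
      Δ-vanish (suc p) v pos = cong₂ _xor_ (Δ-vanish p v pos) (Δ-vanish p (v ⊕ x) (step v (ℤ.<⇒≤ pos)))

      Δ-head : ∀ p v → 0ℤ ℤ.≤ l v → Δ x p h v ≡ h v
      Δ-head zero    v le = refl
      Δ-head (suc p) v le = trans (cong₂ _xor_ (Δ-head p v le) (Δ-vanish p (v ⊕ x) (step v le))) (xor-identityʳ (h v))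

      far : ∀ u → ∣ ℤ.- 1ℤ ℤ.+ l u ∣ ℕ.≤ a → 0ℤ ℤ.< l (u ⊕ double a x)
      far u le = subst (0ℤ ℤ.<_) (sym (shift (graded-double a gl) u))
        (ℤ.≤-<-trans (0≤i+2^a*j (ℤ.- 1ℤ ℤ.+ l u) a m le)
          (subst (ℤ._< l u ℤ.+ + (2 ℕ.^ a) ℤ.* + suc m) (lem (l u) (+ (2 ℕ.^ a) ℤ.* + suc m)) (ℤ.i≤pred[j]⇒i<j ℤ.≤-refl)))
        where
        lem : ∀ i j → ℤ.- 1ℤ ℤ.+ (i ℤ.+ j) ≡ ℤ.- 1ℤ ℤ.+ i ℤ.+ j
        lem = solve-∀

    -- The test cutting out degree < 0 and level ≤ 0 is annihilated by Δ x and by the terms of degree ≥ 0.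
    leading-nonneg : ∀ {δ x W} → Graded δ x 0ℤ → Graded l x 0ℤ → Span δ x 0ℤ (∑ W) → Leading l W → 0ℤ ℤ.≤ δ 𝟘
    leading-nonneg {δ} {x} {W} gδ gl (span L bd rep) lead = ℤ.≮⇒≥ λ neg →
      contradiction (trans (sym (head neg)) (trans (sym (lead h high)) (trans (rep h) (∑-zero L (All.map (λ {(u , p)} → term u p) bd)))))
        λ ()
      where
      h : Test
      h v = ⌊ l v ℤ.≤? 0ℤ ⌋ ∧ ⌊ δ v ℤ.<? 0ℤ ⌋

      periodic : ∀ p u → Δ x p h (u ⊕ x) ≡ Δ x p h u
      periodic zero    u rewrite shift gδ u | shift gl u | ℤ.+-identityʳ (l u) | ℤ.+-identityʳ (δ u) = refl
      periodic (suc p) u = cong₂ _xor_ (periodic p u) (periodic p (u ⊕ x))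

      term : ∀ u p → 0ℤ ℤ.≤ δ u ℤ.+ + p → Δ x p h u ≡ false
      term u (suc p) b = trans (cong (Δ x p h u xor_) (periodic p u)) (xor-same (Δ x p h u))
      term u zero b with l u ℤ.≤? 0ℤ
      ... | no _  = refl
      ... | yes _ with δ u ℤ.<? 0ℤ
      ...   | no _  = refl
      ...   | yes p = contradiction (ℤ.≤-trans b (ℤ.≤-reflexive (ℤ.+-identityʳ (δ u)))) (ℤ.<⇒≱ p)

      high : ∀ v → 0ℤ ℤ.< l v → h v ≡ false
      high v pos with l v ℤ.≤? 0ℤ
      ... | no _  = refl
      ... | yes p = contradiction p (ℤ.<⇒≱ pos)

      head : δ 𝟘 ℤ.< 0ℤ → h 𝟘 ≡ true
      head neg rewrite l𝟘 with δ 𝟘 ℤ.<? 0ℤ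
      ... | yes _ = refl
      ... | no ¬p = contradiction neg ¬p

  record Additive (f : N → ℤ) : Set where
    constructor mkAdditive
    field ⊕-homo : ∀ u v → f (u ⊕ v) ≡ f u ℤ.+ f v

  open Additive

  module _ {f : N → ℤ} (additive : Additive f) where

    private
      add : ∀ u v → f (u ⊕ v) ≡ f u ℤ.+ f v
      add = ⊕-homo additive

    additive-graded : ∀ v → Graded f v (f v)
    additive-graded v .shift u = add u v

    additive-𝟘 : f 𝟘 ≡ 0ℤ
    additive-𝟘 = begin
      f 𝟘                             ≡⟨ lem (f 𝟘) ⟩
      f 𝟘 ℤ.+ f 𝟘 ℤ.+ ℤ.- f 𝟘         ≡⟨ cong (ℤ._+ ℤ.- f 𝟘) (add 𝟘 𝟘) ⟨
      f (𝟘 ⊕ 𝟘) ℤ.+ ℤ.- f 𝟘           ≡⟨ cong (λ v → f v ℤ.+ ℤ.- f 𝟘) (identityʳ 𝟘) ⟩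
      f 𝟘 ℤ.+ ℤ.- f 𝟘                 ≡⟨ ℤ.+-inverseʳ (f 𝟘) ⟩
      0ℤ                              ∎
      where
      open ≡-Reasoning
      lem : ∀ a → a ≡ a ℤ.+ a ℤ.+ ℤ.- a
      lem = solve-∀

    additive-⊖ : ∀ v → f (⊖ v) ≡ ℤ.- f v
    additive-⊖ v = begin
      f (⊖ v)                           ≡⟨ lem (f (⊖ v)) (f v) ⟩
      f (⊖ v) ℤ.+ f v ℤ.+ ℤ.- f v       ≡⟨ cong (ℤ._+ ℤ.- f v) (add (⊖ v) v) ⟨
      f ((⊖ v) ⊕ v) ℤ.+ ℤ.- f v         ≡⟨ cong (ℤ._+ ℤ.- f v) (trans (cong f (inverseˡ v)) additive-𝟘) ⟩
      0ℤ ℤ.+ ℤ.- f v                    ≡⟨ ℤ.+-identityˡ _ ⟩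
      ℤ.- f v                           ∎
      where
      open ≡-Reasoning
      lem : ∀ a b → a ≡ a ℤ.+ b ℤ.+ ℤ.- b
      lem = solve-∀

    additive-· : ∀ k v → f (k · v) ≡ + k ℤ.* f v
    additive-· zero    v = additive-𝟘
    additive-· (suc k) v = trans (add v (k · v)) (trans (cong (ℤ._+_ (f v)) (additive-· k v)) (lem (f v) (+ k)))
      where
      lem : ∀ a k → a ℤ.+ k ℤ.* a ≡ (1ℤ ℤ.+ k) ℤ.* a
      lem = solve-∀

    additive-⊕· : ∀ u k v → f (u ⊕ (k · v)) ≡ f u ℤ.+ + k ℤ.* f v
    additive-⊕· u k v = trans (add u (k · v)) (cong (ℤ._+_ (f u)) (additive-· k v))

  record DualBasis {n} (c : Fin n → N) : Set where
    field
      dual     : Fin n → N → ℤ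
      dual-additive : ∀ i → Additive (dual i)
      diagonal : ∀ i → dual i (c i) ≡ 1ℤ
      off-diag : ∀ {i j} → i ≢ j → dual i (c j) ≡ 0ℤ

  pivot : ∀ {n} → Fin n → (Fin n → ℕ) → (Fin n → N) → Fin n → N
  pivot i p c j with j ≟ i
  ... | yes _ = ⊖ c i
  ... | no  _ = c j ⊕ (p j · c i)

  pivot-≡ : ∀ {n} (i : Fin n) p c → pivot i p c i ≡ ⊖ c i
  pivot-≡ i p c with i ≟ i
  ... | yes _ = refl
  ... | no ne = contradiction refl ne

  pivot-≢ : ∀ {n} {i j : Fin n} p c → j ≢ i → pivot i p c j ≡ c j ⊕ (p j · c i)
  pivot-≢ {i = i} {j} p c ne with j ≟ i
  ... | yes e = contradiction e ne
  ... | no  _ = refl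

  module _ {n} {c : Fin n → N} (db : DualBasis c) (i : Fin n) (p : Fin n → ℕ) (pᵢ≡0 : p i ≡ 0) where
    open DualBasis db

    private
      at-i : N → ℤ
      at-i u = ℤ.- dual i u ℤ.+ sum (λ j → + p j ℤ.* dual j u)

      at-i-additive : Additive at-i
      at-i-additive .⊕-homo u v = begin
        ℤ.- dual i (u ⊕ v) ℤ.+ sum (λ j → + p j ℤ.* dual j (u ⊕ v))
          ≡⟨ cong₂ (λ a b → ℤ.- a ℤ.+ b) (⊕-homo (dual-additive i) u v)
               (trans (sum-cong-≗ (λ j → trans (cong (ℤ._*_ (+ p j)) (⊕-homo (dual-additive j) u v)) (ℤ.*-distribˡ-+ (+ p j) _ _)))
                      (∑-distrib-+ (λ j → + p j ℤ.* dual j u) _)) ⟩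
        ℤ.- (dual i u ℤ.+ dual i v) ℤ.+ (s u ℤ.+ s v)
          ≡⟨ lem (dual i u) (dual i v) (s u) (s v) ⟩
        at-i u ℤ.+ at-i v ∎
        where
        open ≡-Reasoning
        s : N → ℤ
        s u = sum (λ j → + p j ℤ.* dual j u)
        lem : ∀ a b c d → ℤ.- (a ℤ.+ b) ℤ.+ (c ℤ.+ d) ≡ (ℤ.- a ℤ.+ c) ℤ.+ (ℤ.- b ℤ.+ d)
        lem = solve-∀

      at-i-basis : ∀ x → at-i (c x) ≡ ℤ.- dual i (c x) ℤ.+ + p x
      at-i-basis x = cong (ℤ._+_ (ℤ.- dual i (c x))) (begin
        sum (λ j → + p j ℤ.* dual j (c x))
          ≡⟨ sum-single _ x (λ j ne → trans (cong (ℤ._*_ (+ p j)) (off-diag ne)) (ℤ.*-zeroʳ (+ p j))) ⟩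
        + p x ℤ.* dual x (c x)     ≡⟨ cong (ℤ._*_ (+ p x)) (diagonal x) ⟩
        + p x ℤ.* 1ℤ               ≡⟨ ℤ.*-identityʳ (+ p x) ⟩
        + p x                      ∎)
        where open ≡-Reasoning

      at-i-cᵢ : at-i (c i) ≡ ℤ.- 1ℤ
      at-i-cᵢ = trans (at-i-basis i) (cong₂ (λ a b → ℤ.- a ℤ.+ + b) (diagonal i) pᵢ≡0)

    dual-pivot : Fin n → N → ℤ
    dual-pivot j with j ≟ i
    ... | yes _ = at-i
    ... | no  _ = dual j

    pivot-dualBasis : DualBasis (pivot i p c)
    pivot-dualBasis = record
      { dual     = dual-pivot
      ; dual-additive = add
      ; diagonal = diag
      ; off-diag = off
      }
      where
      add : ∀ j → Additive (dual-pivot j)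
      add j with j ≟ i
      ... | yes _ = at-i-additive
      ... | no  _ = dual-additive j

      diag : ∀ j → dual-pivot j (pivot i p c j) ≡ 1ℤ
      diag j with j ≟ i
      ... | yes _ = trans (additive-⊖ at-i-additive (c i)) (cong ℤ.-_ at-i-cᵢ)
      ... | no ne = trans (additive-⊕· (dual-additive j) (c j) (p j) (c i))
        (trans (cong₂ (λ a b → a ℤ.+ + p j ℤ.* b) (diagonal j) (off-diag ne)) (cong (ℤ._+_ 1ℤ) (ℤ.*-zeroʳ (+ p j))))

      off : ∀ {j x} → j ≢ x → dual-pivot j (pivot i p c x) ≡ 0ℤ
      off {j} {x} j≢x with j ≟ i | x ≟ i
      ... | yes refl | yes refl = contradiction refl j≢x
      ... | yes refl | no x≢i   = begin
        at-i (c x ⊕ (p x · c i))                       ≡⟨ additive-⊕· at-i-additive (c x) (p x) (c i) ⟩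
        at-i (c x) ℤ.+ + p x ℤ.* at-i (c i)            ≡⟨ cong₂ (λ a b → a ℤ.+ + p x ℤ.* b) (at-i-basis x) at-i-cᵢ ⟩
        ℤ.- dual i (c x) ℤ.+ + p x ℤ.+ + p x ℤ.* ℤ.- 1ℤ
          ≡⟨ cong (λ a → ℤ.- a ℤ.+ + p x ℤ.+ + p x ℤ.* ℤ.- 1ℤ) (off-diag j≢x) ⟩
        0ℤ ℤ.+ + p x ℤ.+ + p x ℤ.* ℤ.- 1ℤ              ≡⟨ lem (+ p x) ⟩
        0ℤ                                             ∎
        where
        open ≡-Reasoning
        lem : ∀ p → 0ℤ ℤ.+ p ℤ.+ p ℤ.* ℤ.- 1ℤ ≡ 0ℤ
        lem = solve-∀
      ... | no j≢i   | yes refl = trans (additive-⊖ (dual-additive j) (c i)) (cong ℤ.-_ (off-diag j≢i))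
      ... | no j≢i   | no x≢i   = trans (additive-⊕· (dual-additive j) (c x) (p x) (c i))
        (trans (cong₂ (λ a b → a ℤ.+ + p x ℤ.* b) (off-diag j≢x) (off-diag j≢i)) (cong (ℤ._+_ 0ℤ) (ℤ.*-zeroʳ (+ p x))))

    dual-pivot-≢ : ∀ {j} → j ≢ i → ∀ u → dual-pivot j u ≡ dual j u
    dual-pivot-≢ {j} ne u with j ≟ i
    ... | yes e = contradiction e ne
    ... | no _  = refl

  module _ {ω : N → N → ℤ} (ω-additive : ∀ u → Additive (ω u)) (ω-skew : ∀ u v → ω u v ≡ ℤ.- ω v u) where

    ω-alternating : ∀ u → ω u u ≡ 0ℤ
    ω-alternating u = lem (ω u u) (ω-skew u u)
      where
      lem : ∀ z → z ≡ ℤ.- z → z ≡ 0ℤ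
      lem (+ zero) e = refl
      lem +[1+ _ ] ()
      lem -[1+ _ ] ()

    ω-additiveˡ : ∀ v → Additive (λ u → ω u v)
    ω-additiveˡ v .⊕-homo u u′ = begin
      ω (u ⊕ u′) v                       ≡⟨ ω-skew (u ⊕ u′) v ⟩
      ℤ.- ω v (u ⊕ u′)                   ≡⟨ cong ℤ.-_ (⊕-homo (ω-additive v) u u′) ⟩
      ℤ.- (ω v u ℤ.+ ω v u′)             ≡⟨ ℤ.neg-distrib-+ (ω v u) (ω v u′) ⟩
      ℤ.- ω v u ℤ.+ ℤ.- ω v u′           ≡⟨ cong₂ ℤ._+_ (ω-skew u v) (ω-skew u′ v) ⟨
      ω u v ℤ.+ ω u′ v                   ∎
      where open ≡-Reasoning

    mutateSeed : ∀ {n} → Fin n → (Fin n → N) → Fin n → N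
    mutateSeed i c = pivot i (λ j → pos (ω (c i) (c j))) c

    mutateSeeds : ∀ {n} → List (Fin n) → (Fin n → N) → Fin n → N
    mutateSeeds []       c = c
    mutateSeeds (i ∷ is) c = mutateSeeds is (mutateSeed i c)

    mutateSeed-dualBasis : ∀ {n} {c : Fin n → N} i → DualBasis c → DualBasis (mutateSeed i c)
    mutateSeed-dualBasis {c = c} i db = pivot-dualBasis db i _ (cong pos (ω-alternating (c i)))

    Along : ∀ {n} → (N → Set) → (Fin n → N) → List (Fin n) → Set
    Along P c []       = ⊤
    Along P c (i ∷ is) = P (c i) × Along P (mutateSeed i c) is

    mutateSeeds-++ : ∀ {n} is {js} (c : Fin n → N) → mutateSeeds (is ++ js) c ≡ mutateSeeds js (mutateSeeds is c)
    mutateSeeds-++ []       c = refl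
    mutateSeeds-++ (i ∷ is) c = mutateSeeds-++ is (mutateSeed i c)

    along-map : ∀ {n P R} (c : Fin n → N) is → (∀ {v} → P v → R v) → Along P c is → Along R c is
    along-map c []       f _        = tt
    along-map c (i ∷ is) f (h , hs) = f h , along-map _ is f hs

    along-++⁺ : ∀ {n P} (c : Fin n → N) is {js} → Along P c is → Along P (mutateSeeds is c) js → Along P c (is ++ js)
    along-++⁺ c []       _        hs′ = hs′
    along-++⁺ c (i ∷ is) (h , hs) hs′ = h , along-++⁺ _ is hs hs′

    along-++⁻ : ∀ {n P} (c : Fin n → N) is {js} → Along P c (is ++ js) → Along P c is × Along P (mutateSeeds is c) js
    along-++⁻ c []       hs       = tt , hs
    along-++⁻ c (i ∷ is) (h , hs) = let hs₁ , hs₂ = along-++⁻ _ is hs in (h , hs₁) , hs₂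

    mutateSeed-cong : ∀ {n} {c c′ : Fin n → N} i → c ≗ c′ → mutateSeed i c ≗ mutateSeed i c′
    mutateSeed-cong i e j with j ≟ i
    ... | yes _ = cong ⊖_ (e i)
    ... | no _ rewrite e i | e j = refl

    mutateSeeds-cong : ∀ {n} {c c′ : Fin n → N} is → c ≗ c′ → mutateSeeds is c ≗ mutateSeeds is c′
    mutateSeeds-cong []       e = e
    mutateSeeds-cong (i ∷ is) e = mutateSeeds-cong is (mutateSeed-cong i e)

    along-cong : ∀ {n P} {c c′ : Fin n → N} is → c ≗ c′ → Along P c is → Along P c′ is
    along-cong         []       e _        = tt
    along-cong {P = P} (i ∷ is) e (h , hs) = subst P (e i) h , along-cong is (mutateSeed-cong i e) hs

    -- The vector u stands for the monomial x^g ŷᵘ, whose exponent at the cluster variable of c is degree c u.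
    module _ {g : N → ℤ} (g-additive : Additive g) where

      degree : N → N → ℤ
      degree c u = g c ℤ.+ ω c u

      degree-graded : ∀ {c v m} → ω c v ≡ m → Graded (degree c) v m
      degree-graded {c} {v} refl .shift u =
        trans (cong (ℤ._+_ (g c)) (⊕-homo (ω-additive c) u v)) (sym (ℤ.+-assoc (g c) (ω c u) (ω c v)))

      degree-self : ∀ c → Graded (degree c) c 0ℤ
      degree-self c = degree-graded (ω-alternating c)

      degree-additive : ∀ u → Additive (λ c → degree c u)
      degree-additive u .⊕-homo c c′ = trans (cong₂ ℤ._+_ (⊕-homo g-additive c c′) (⊕-homo (ω-additiveˡ u) c c′)) (lem (g c) (g c′) (ω c u) (ω c′ u))
        where
        lem : ∀ a b c d → (a ℤ.+ b) ℤ.+ (c ℤ.+ d) ≡ (a ℤ.+ c) ℤ.+ (b ℤ.+ d)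
        lem = solve-∀

      Regular : ∀ {n} → (Fin n → N) → List N → Set
      Regular c W = ∀ j → Span (degree (c j)) (c j) 0ℤ (∑ W)

      regular-𝟘 : ∀ {n} {c : Fin n → N} → (∀ j → 0ℤ ℤ.≤ g (c j)) → Regular c (𝟘 ∷ [])
      regular-𝟘 {c = c} nonneg j = span-resp (λ h → xor-identityʳ (h 𝟘))
        (span-point 𝟘 (subst (0ℤ ℤ.≤_) (sym (trans (cong (ℤ._+_ (g (c j))) (additive-𝟘 (ω-additive (c j))))
          (ℤ.+-identityʳ (g (c j))))) (nonneg j)))

      regular-mutate : ∀ {n} {c : Fin n → N} {W W′} i → DualBasis c → Crossing (degree (c i)) (c i) W W′ →
                       Regular c W → Regular (mutateSeed i c) W′
      regular-mutate {c = c} {W} {W′} i db cr reg j with j ≟ i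
      ... | yes refl = span-reverse _ (c i) cr (degree-self (c i)) (λ u → additive-⊖ (degree-additive u) (c i))
      ... | no j≢i   = case (ω (c i) (c j)) refl
        where
        open DualBasis db
        case : ∀ e → ω (c i) (c j) ≡ e →
               Span (degree (c j ⊕ (pos e · c i))) (c j ⊕ (pos e · c i)) 0ℤ (∑ W′)
        case (+ zero) eq = subst (λ v → Span (degree v) v 0ℤ (∑ W′)) (sym (identityʳ (c j)))
          (span-separate {W = W′}
            (graded-≡ (off-diag (λ e → j≢i (sym e))) (additive-graded (dual-additive i) (c j)))
            (graded-≡ (diagonal i) (additive-graded (dual-additive i) (c i)))
            (span-crossing⁻ cr (degree-self (c i)) {m = 0}
              (degree-graded (trans (ω-skew (c j) (c i)) (cong ℤ.-_ eq))) (degree-graded eq) (reg j)))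
        case -[1+ m ] eq = subst (λ v → Span (degree v) v 0ℤ (∑ W′)) (sym (identityʳ (c j)))
          (span-reflect {W = W′} graded-x
            (span-crossing⁻ cr (degree-self (c i)) graded-x (degree-graded eq) (reg j)))
          where
          graded-x : Graded (degree (c j)) (c i) (+ suc m)
          graded-x = degree-graded (trans (ω-skew (c j) (c i)) (cong ℤ.-_ eq))
        case +[1+ m ] eq = span-reflect {W = W′} (graded-≡ (ℤ.neg-involutive +[1+ m ]) (graded-⊖ graded-x))
          (span-crossing⁺ cr (degree-self (c i)) (λ u → additive-⊕· (degree-additive u) (c j) (suc m) (c i))
            graded-x (degree-graded eq) (degree-self _) (reg j))
          where
          graded-x : Graded (degree (c j ⊕ (suc m · c i))) (c i) (ℤ.- +[1+ m ])
          graded-x = degree-graded (begin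
            ω (c j ⊕ (suc m · c i)) (c i)
              ≡⟨ additive-⊕· (ω-additiveˡ (c i)) (c j) (suc m) (c i) ⟩
            ω (c j) (c i) ℤ.+ +[1+ m ] ℤ.* ω (c i) (c i)
              ≡⟨ cong₂ (λ a b → a ℤ.+ +[1+ m ] ℤ.* b) (trans (ω-skew (c j) (c i)) (cong ℤ.-_ eq)) (ω-alternating (c i)) ⟩
            ℤ.- +[1+ m ] ℤ.+ +[1+ m ] ℤ.* 0ℤ
              ≡⟨ trans (cong (ℤ._+_ (ℤ.- +[1+ m ])) (ℤ.*-zeroʳ +[1+ m ])) (ℤ.+-identityʳ (ℤ.- +[1+ m ])) ⟩
            ℤ.- +[1+ m ] ∎)
            where open ≡-Reasoning

    positivity : ∀ {n} {c : Fin n → N} {g l} (is : List (Fin n)) (j : Fin n) →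
                 DualBasis c → Additive g → Additive l → (∀ x → 0ℤ ℤ.≤ g (c x)) → Along (λ v → 0ℤ ℤ.< l v) c is →
                 l (mutateSeeds is c j) ≡ 0ℤ → 0ℤ ℤ.≤ g (mutateSeeds is c j)
    positivity {n} {g = g} {l} is j db g-additive l-additive nonneg above level =
      go {W = 𝟘 ∷ []} is db above (regular-𝟘 g-additive nonneg) (λ h _ → xor-identityʳ (h 𝟘)) level
      where
      l𝟘 = additive-𝟘 l-additive

      go : ∀ {c : Fin n → N} {W} is → DualBasis c → Along (λ v → 0ℤ ℤ.< l v) c is → Regular g-additive c W → Leading l W →
           l (mutateSeeds is c j) ≡ 0ℤ → 0ℤ ℤ.≤ g (mutateSeeds is c j)
      go {c} {W} [] db above reg lead level = subst (0ℤ ℤ.≤_)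
        (trans (cong (ℤ._+_ (g (c j))) (additive-𝟘 (ω-additive (c j)))) (ℤ.+-identityʳ (g (c j))))
        (leading-nonneg l𝟘 {W = W} (degree-self g-additive (c j)) (graded-≡ level (additive-graded l-additive (c j))) (reg j) lead)
      go {c} {W} (i ∷ is) db (pos-i , above) reg lead level with ∃-crossing _ _ {W} (reg i)
      ... | W′ , cr = go {W = W′} is (mutateSeed-dualBasis i db) above (regular-mutate g-additive {W = W} i db cr reg)
        (leading-crossing l𝟘 cr (degree-self g-additive (c i)) (raise (l (c i)) pos-i refl) lead) level
        where
        raise : ∀ e → 0ℤ ℤ.< e → l (c i) ≡ e → Graded l (c i) (+ suc (ℕ.pred (pos e)))
        raise +[1+ m ] _ eq = graded-≡ eq (additive-graded l-additive (c i))
        raise (+ zero) (ℤ.+<+ ()) _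

module _ {V : Set} where

  net : QuiverOn V → V → V → ℤ
  net a x y = + a x y ℤ.- + a y x

  net-swap : ∀ a x y → net a x y ≡ ℤ.- net a y x
  net-swap a x y = lem (+ a x y) (+ a y x)
    where
    lem : ∀ i j → i ℤ.- j ≡ ℤ.- (j ℤ.- i)
    lem = solve-∀

  arrows : ∀ {a} → IsQuiver a → ∀ {d} x y → net a x y ≡ d → a x y ≡ pos d
  arrows {a} (_ , acyclic) x y refl with a x y | a y x | acyclic x y
  ... | _     | zero  | inj₁ refl = refl
  ... | _     | suc _ | inj₁ refl = refl
  ... | zero  | _     | inj₂ refl = refl
  ... | suc m | _     | inj₂ refl = cong suc (sym (ℕ.+-identityʳ m))

  module _ (_≟V_ : DecidableEquality V) (k : V) (a : QuiverOn V) where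

    mutate-source : ∀ y → mutate _≟V_ k a k y ≡ a y k
    mutate-source y with k ≟V k
    ... | yes _ = refl
    ... | no ne = contradiction refl ne

    mutate-target : ∀ {x} → x ≢ k → mutate _≟V_ k a x k ≡ a k x
    mutate-target {x} ne with x ≟V k | k ≟V k
    ... | yes e | _     = contradiction e ne
    ... | no _  | yes _ = refl
    ... | no _  | no n′ = contradiction refl n′

    mutate-other : ∀ {x y} → x ≢ k → y ≢ k →
                   mutate _≟V_ k a x y ≡ (a x y ℕ.+ a x k ℕ.* a k y) ∸ (a y x ℕ.+ a y k ℕ.* a k x)
    mutate-other {x} {y} x≢k y≢k with x ≟V k | y ≟V k
    ... | yes e | _     = contradiction e x≢k
    ... | no _  | yes e = contradiction e y≢k
    ... | no _  | no _  = refl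

    mutate-isQuiver : IsQuiver a → IsQuiver (mutate _≟V_ k a)
    mutate-isQuiver (loopless , acyclic) = loops , cycles
      where
      loops : ∀ x → mutate _≟V_ k a x x ≡ 0
      loops x with x ≟V k
      ... | yes refl = loopless k
      ... | no _     = ℕ.n∸n≡0 (a x x ℕ.+ a x k ℕ.* a k x)

      cycles : ∀ x y → (mutate _≟V_ k a x y ≡ 0) ⊎ (mutate _≟V_ k a y x ≡ 0)
      cycles x y with x ≟V k | y ≟V k
      ... | yes refl | yes refl = inj₁ (loopless k)
      ... | yes refl | no _     = acyclic y k
      ... | no _     | yes refl = acyclic k x
      ... | no _     | no _     with ℕ.≤-total (a x y ℕ.+ a x k ℕ.* a k y) (a y x ℕ.+ a y k ℕ.* a k x)
      ...   | inj₁ le = inj₁ (ℕ.m≤n⇒m∸n≡0 le)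
      ...   | inj₂ ge = inj₂ (ℕ.m≤n⇒m∸n≡0 ge)

    net-mutate-source : ∀ y → net (mutate _≟V_ k a) k y ≡ net a y k
    net-mutate-source y = go (y ≟V k)
      where
      go : Dec (y ≡ k) → net (mutate _≟V_ k a) k y ≡ net a y k
      go (yes refl) = cong₂ (λ m n → + m ℤ.- + n) (mutate-source k) (mutate-source k)
      go (no y≢k)   = cong₂ (λ m n → + m ℤ.- + n) (mutate-source y) (mutate-target y≢k)

    net-mutate-other : ∀ {x y} → x ≢ k → y ≢ k →
      net (mutate _≟V_ k a) x y ≡ net a x y ℤ.+ (+ a x k ℤ.* + a k y ℤ.- + a y k ℤ.* + a k x)
    net-mutate-other {x} {y} x≢k y≢k = begin
      net (mutate _≟V_ k a) x y
        ≡⟨ cong₂ (λ m n → + m ℤ.- + n) (mutate-other x≢k y≢k) (mutate-other y≢k x≢k) ⟩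
      + (P ∸ P′) ℤ.- + (P′ ∸ P)
        ≡⟨ ∸-net P P′ ⟩
      + P ℤ.- + P′
        ≡⟨ cong₂ (λ i j → (+ a x y ℤ.+ i) ℤ.- (+ a y x ℤ.+ j)) (ℤ.pos-* (a x k) (a k y)) (ℤ.pos-* (a y k) (a k x)) ⟩
      (+ a x y ℤ.+ + a x k ℤ.* + a k y) ℤ.- (+ a y x ℤ.+ + a y k ℤ.* + a k x)
        ≡⟨ rearrange (+ a x y) (+ a x k ℤ.* + a k y) (+ a y x) (+ a y k ℤ.* + a k x) ⟩
      net a x y ℤ.+ (+ a x k ℤ.* + a k y ℤ.- + a y k ℤ.* + a k x) ∎
      where
      open ≡-Reasoning
      P  = a x y ℕ.+ a x k ℕ.* a k y
      P′ = a y x ℕ.+ a y k ℕ.* a k x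
      rearrange : ∀ i j i′ j′ → (i ℤ.+ j) ℤ.- (i′ ℤ.+ j′) ≡ (i ℤ.- i′) ℤ.+ (j ℤ.- j′)
      rearrange = solve-∀
      cancel : ∀ i j → i ℤ.- j ≡ (1ℤ ℤ.+ i) ℤ.- (1ℤ ℤ.+ j)
      cancel = solve-∀
      ∸-net : ∀ m n → + (m ∸ n) ℤ.- + (n ∸ m) ≡ + m ℤ.- + n
      ∸-net zero    zero    = refl
      ∸-net zero    (suc n) = refl
      ∸-net (suc m) zero    = refl
      ∸-net (suc m) (suc n) = trans (∸-net m n) (cancel (+ m) (+ n))

_≟V_ : ∀ {n} → DecidableEquality (FVert n)
_≟V_ = ≡-dec _≟_ _≟_

mutablePart : ∀ {n} → FQuiver n → Quiver n
mutablePart F x y = F (inj₁ x) (inj₁ y)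

μF-mutablePart : ∀ {n} k (F : FQuiver n) x y → mutablePart (μF k F) x y ≡ μ k (mutablePart F) x y
μF-mutablePart k F x y = go (x ≟ k) (y ≟ k)
  where
  inj₁-≢ : ∀ {x} → x ≢ k → inj₁ x ≢ inj₁ k
  inj₁-≢ ne e = ne (inj₁-injective e)
  go : Dec (x ≡ k) → Dec (y ≡ k) → mutablePart (μF k F) x y ≡ μ k (mutablePart F) x y
  go (yes refl) _          =
    trans (mutate-source _≟V_ (inj₁ k) F (inj₁ y)) (sym (mutate-source _≟_ k (mutablePart F) y))
  go (no x≢k)   (yes refl) =
    trans (mutate-target _≟V_ (inj₁ k) F (inj₁-≢ x≢k)) (sym (mutate-target _≟_ k (mutablePart F) x≢k))
  go (no x≢k)   (no y≢k)   =
    trans (mutate-other _≟V_ (inj₁ k) F (inj₁-≢ x≢k) (inj₁-≢ y≢k))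
          (sym (mutate-other _≟_ k (mutablePart F) x≢k y≢k))

μF-isQuiver : ∀ {n} k {F : FQuiver n} → IsQuiver F → IsQuiver (μF k F)
μF-isQuiver k {F} isQ with mutate-isQuiver _≟V_ (inj₁ k) F isQ
... | loopless , acyclic = loops , cycles
  where
  loops : ∀ x → μF k F x x ≡ 0
  loops (inj₁ x) = loopless (inj₁ x)
  loops (inj₂ x) = refl
  cycles : ∀ x y → (μF k F x y ≡ 0) ⊎ (μF k F y x ≡ 0)
  cycles (inj₁ x) (inj₁ y) = acyclic (inj₁ x) (inj₁ y)
  cycles (inj₁ x) (inj₂ y) = acyclic (inj₁ x) (inj₂ y)
  cycles (inj₂ x) (inj₁ y) = acyclic (inj₂ x) (inj₁ y)
  cycles (inj₂ x) (inj₂ y) = inj₁ refl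

framed-isQuiver : ∀ {n} {Q : Quiver n} → IsQuiver Q → IsQuiver (framed Q)
framed-isQuiver {Q = Q} (loopless , acyclic) = loops , cycles
  where
  loops : ∀ x → framed Q x x ≡ 0
  loops (inj₁ x) = loopless x
  loops (inj₂ x) = refl
  cycles : ∀ x y → (framed Q x y ≡ 0) ⊎ (framed Q y x ≡ 0)
  cycles (inj₁ x) (inj₁ y) = acyclic x y
  cycles (inj₁ x) (inj₂ y) = inj₂ refl
  cycles (inj₂ x) y        = inj₁ refl

δ-diagonal : ∀ {n} (i : Fin n) → δ i i ≡ 1
δ-diagonal i with i ≟ i
... | yes _ = refl
... | no ne = contradiction refl ne

δ-off-diag : ∀ {n} {i j : Fin n} → i ≢ j → δ i j ≡ 0
δ-off-diag {i = i} {j} ne with i ≟ j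
... | yes e = contradiction e ne
... | no _  = refl

δ-sym : ∀ {n} (i j : Fin n) → δ i j ≡ δ j i
δ-sym i j = go (i ≟ j)
  where
  go : Dec (i ≡ j) → δ i j ≡ δ j i
  go (yes refl) = refl
  go (no ne)    = trans (δ-off-diag ne) (sym (δ-off-diag (λ e → ne (sym e))))

Lattice : ℕ → Set
Lattice n = Vec ℤ n

_+ᵛ_ : ∀ {n} → Lattice n → Lattice n → Lattice n
_+ᵛ_ = zipWith ℤ._+_

-ᵛ_ : ∀ {n} → Lattice n → Lattice n
-ᵛ_ = Vec.map (λ i → ℤ.- i)

+ᵛ-isAbelianGroup : ∀ {n} → IsAbelianGroup _≡_ (_+ᵛ_ {n}) (replicate n 0ℤ) -ᵛ_
+ᵛ-isAbelianGroup = record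
  { isGroup = record
    { isMonoid = record
      { isSemigroup = record
        { isMagma = record { isEquivalence = isEquivalence ; ∙-cong = cong₂ _+ᵛ_ }
        ; assoc   = Vec.zipWith-assoc ℤ.+-assoc
        }
      ; identity = Vec.zipWith-identityˡ ℤ.+-identityˡ , Vec.zipWith-identityʳ ℤ.+-identityʳ
      }
    ; inverse = Vec.zipWith-inverseˡ ℤ.+-inverseˡ , Vec.zipWith-inverseʳ ℤ.+-inverseʳ
    ; ⁻¹-cong = cong -ᵛ_
    }
  ; comm = Vec.zipWith-comm ℤ.+-comm
  }

+ᵛ-abelianGroup : ℕ → AbelianGroup _ _
+ᵛ-abelianGroup n = record { isAbelianGroup = +ᵛ-isAbelianGroup {n} }

module _ {n : ℕ} where

  open Laurent (+ᵛ-isAbelianGroup {n}) public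
  open Additive public
  open import Algebra.Properties.Monoid.Mult (AbelianGroup.monoid (+ᵛ-abelianGroup n)) public
    using () renaming (_×_ to _·_)

  coord : Fin n → Lattice n → ℤ
  coord j u = lookup u j

  coord-additive : ∀ j → Additive (coord j)
  coord-additive j .⊕-homo u v = Vec.lookup-zipWith ℤ._+_ j u v

  coord-injective : ∀ {u v} → (∀ j → coord j u ≡ coord j v) → u ≡ v
  coord-injective {u} {v} e =
    trans (sym (Vec.tabulate∘lookup u)) (trans (Vec.tabulate-cong e) (Vec.tabulate∘lookup v))

  basis : Fin n → Lattice n
  basis i = tabulate (λ j → + δ i j)

  coord-basis : ∀ j i → coord j (basis i) ≡ + δ i j
  coord-basis j i = Vec.lookup∘tabulate (λ j → + δ i j) j

  basis-dualBasis : DualBasis basis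
  basis-dualBasis = record
    { dual          = coord
    ; dual-additive = coord-additive
    ; diagonal      = λ i → trans (coord-basis i i) (cong +_ (δ-diagonal i))
    ; off-diag      = λ {j} {i} ne → trans (coord-basis j i) (cong +_ (δ-off-diag (λ e → ne (sym e))))
    }

  sum-additive : ∀ {m} {f : Fin m → Lattice n → ℤ} → (∀ i → Additive (f i)) → Additive (λ u → sum (λ i → f i u))
  sum-additive {f = f} add .⊕-homo u v =
    trans (sum-cong-≗ (λ i → ⊕-homo (add i) u v)) (∑-distrib-+ (λ i → f i u) (λ i → f i v))

  *-additive : ∀ {f : Lattice n → ℤ} a → Additive f → Additive (λ u → a ℤ.* f u)
  *-additive {f} a add .⊕-homo u v = trans (cong (ℤ._*_ a) (⊕-homo add u v)) (ℤ.*-distribˡ-+ a (f u) (f v))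

  +-additive : ∀ {f g : Lattice n → ℤ} → Additive f → Additive g → Additive (λ u → f u ℤ.+ g u)
  +-additive {f} {g} addf addg .⊕-homo u v =
    trans (cong₂ ℤ._+_ (⊕-homo addf u v) (⊕-homo addg u v)) (lem (f u) (f v) (g u) (g v))
    where
    lem : ∀ a b c d → (a ℤ.+ b) ℤ.+ (c ℤ.+ d) ≡ (a ℤ.+ c) ℤ.+ (b ℤ.+ d)
    lem = solve-∀

  sum-neg : ∀ {m} (t : Fin m → ℤ) → sum (λ i → ℤ.- t i) ≡ ℤ.- sum t
  sum-neg {zero}  t = refl
  sum-neg {suc m} t = trans (cong (ℤ._+_ (ℤ.- t zero)) (sum-neg (λ i → t (suc i)))) (sym (ℤ.neg-distrib-+ (t zero) _))

  module Form (Q : Quiver n) where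

    ω : Lattice n → Lattice n → ℤ
    ω u v = sum λ i → sum λ j → coord i u ℤ.* net Q j i ℤ.* coord j v

    ω-additive : ∀ u → Additive (ω u)
    ω-additive u = sum-additive λ i → sum-additive λ j → *-additive (coord i u ℤ.* net Q j i) (coord-additive j)

    ω-skew : ∀ u v → ω u v ≡ ℤ.- ω v u
    ω-skew u v = begin
      sum (λ i → sum λ j → coord i u ℤ.* net Q j i ℤ.* coord j v)
        ≡⟨ ∑-comm (λ i j → coord i u ℤ.* net Q j i ℤ.* coord j v) ⟩
      sum (λ j → sum λ i → coord i u ℤ.* net Q j i ℤ.* coord j v)
        ≡⟨ sum-cong-≗ (λ j → sum-cong-≗ λ i → trans (cong (λ b → coord i u ℤ.* b ℤ.* coord j v) (net-swap Q j i))
             (lem (coord i u) (net Q i j) (coord j v))) ⟩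
      sum (λ j → sum λ i → ℤ.- (coord j v ℤ.* net Q i j ℤ.* coord i u))
        ≡⟨ sum-cong-≗ (λ j → sum-neg λ i → coord j v ℤ.* net Q i j ℤ.* coord i u) ⟩
      sum (λ j → ℤ.- sum λ i → coord j v ℤ.* net Q i j ℤ.* coord i u)
        ≡⟨ sum-neg (λ j → sum λ i → coord j v ℤ.* net Q i j ℤ.* coord i u) ⟩
      ℤ.- ω v u ∎
      where
      open ≡-Reasoning
      lem : ∀ a b c → a ℤ.* ℤ.- b ℤ.* c ≡ ℤ.- (c ℤ.* b ℤ.* a)
      lem = solve-∀

    ω-basis : ∀ y x → ω (basis y) (basis x) ≡ net Q x y
    ω-basis y x = begin
      ω (basis y) (basis x)
        ≡⟨ sum-single _ y (λ i ne → sum-zero _ λ j → cong (λ a → a ℤ.* net Q j i ℤ.* coord j (basis x)) (off-diag ne)) ⟩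
      sum (λ j → coord y (basis y) ℤ.* net Q j y ℤ.* coord j (basis x))
        ≡⟨ sum-single _ x (λ j ne → trans (cong (λ a → coord y (basis y) ℤ.* net Q j y ℤ.* a) (off-diag ne)) (ℤ.*-zeroʳ (coord y (basis y) ℤ.* net Q j y))) ⟩
      coord y (basis y) ℤ.* net Q x y ℤ.* coord x (basis x)
        ≡⟨ cong₂ (λ a b → a ℤ.* net Q x y ℤ.* b) (diagonal y) (diagonal x) ⟩
      1ℤ ℤ.* net Q x y ℤ.* 1ℤ
        ≡⟨ trans (ℤ.*-identityʳ _) (ℤ.*-identityˡ (net Q x y)) ⟩
      net Q x y ∎
      where
      open ≡-Reasoning
      open DualBasis basis-dualBasis

  module Realization {ω : Lattice n → Lattice n → ℤ}
    (ω-additive : ∀ u → Additive (ω u)) (ω-skew : ∀ u v → ω u v ≡ ℤ.- ω v u) where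

    private
      ωˡ = ω-additiveˡ ω-additive ω-skew
      mutateSeed′ = mutateSeed ω-additive ω-skew
      mutateSeeds′ = mutateSeeds ω-additive ω-skew
      Along′ = Along ω-additive ω-skew

    Presents : (Fin n → Lattice n) → Quiver n → Set
    Presents c a = ∀ x y → net a x y ≡ ω (c y) (c x)

    pivot-presents : ∀ {c a} k p → Presents c a →
      (∀ x y → + p x ℤ.* net a k y ℤ.+ + p y ℤ.* net a x k ≡ + a x k ℤ.* + a k y ℤ.- + a y k ℤ.* + a k x) →
      Presents (pivot k p c) (μ k a)
    pivot-presents {c} {a} k p pres weights x y = go (x ≟ k) (y ≟ k)
      where
      open ≡-Reasoning
      source : ∀ y → net (μ k a) k y ≡ ω (pivot k p c y) (pivot k p c k)
      source y = begin
        net (μ k a) k y                       ≡⟨ net-mutate-source _≟_ k a y ⟩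
        net a y k                             ≡⟨ net-swap a y k ⟩
        ℤ.- net a k y                         ≡⟨ cong (λ i → ℤ.- i) (pres k y) ⟩
        ℤ.- ω (c y) (c k)                     ≡⟨ go (y ≟ k) ⟩
        ω (pivot k p c y) (-ᵛ c k)            ≡⟨ cong (ω (pivot k p c y)) (pivot-≡ k p c) ⟨
        ω (pivot k p c y) (pivot k p c k)     ∎
        where
        lem : ∀ a p → a ≡ a ℤ.+ p ℤ.* 0ℤ
        lem = solve-∀
        go : Dec (y ≡ k) → ℤ.- ω (c y) (c k) ≡ ω (pivot k p c y) (-ᵛ c k)
        go (yes refl) = begin
          ℤ.- ω (c k) (c k)                   ≡⟨ cong (λ i → ℤ.- i) (ω-alternating ω-additive ω-skew (c k)) ⟩
          0ℤ                                  ≡⟨ ω-alternating ω-additive ω-skew (-ᵛ c k) ⟨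
          ω (-ᵛ c k) (-ᵛ c k)                 ≡⟨ cong (λ v → ω v (-ᵛ c k)) (pivot-≡ k p c) ⟨
          ω (pivot k p c k) (-ᵛ c k)          ∎
        go (no ne) = begin
          ℤ.- ω (c y) (c k)                               ≡⟨ cong (λ i → ℤ.- i) (lem (ω (c y) (c k)) (+ p y)) ⟩
          ℤ.- (ω (c y) (c k) ℤ.+ + p y ℤ.* 0ℤ)
            ≡⟨ cong (λ a → ℤ.- (ω (c y) (c k) ℤ.+ + p y ℤ.* a)) (ω-alternating ω-additive ω-skew (c k)) ⟨
          ℤ.- (ω (c y) (c k) ℤ.+ + p y ℤ.* ω (c k) (c k))
            ≡⟨ cong (λ i → ℤ.- i) (additive-⊕· (ωˡ (c k)) (c y) (p y) (c k)) ⟨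
          ℤ.- ω (c y +ᵛ (p y · c k)) (c k)                ≡⟨ additive-⊖ (ω-additive _) (c k) ⟨
          ω (c y +ᵛ (p y · c k)) (-ᵛ c k)                 ≡⟨ cong (λ v → ω v (-ᵛ c k)) (pivot-≢ p c ne) ⟨
          ω (pivot k p c y) (-ᵛ c k)                      ∎

      expand-form : ∀ x y → ω (c y +ᵛ (p y · c k)) (c x +ᵛ (p x · c k)) ≡
        ω (c y) (c x) ℤ.+ (+ p x ℤ.* ω (c y) (c k) ℤ.+ + p y ℤ.* ω (c k) (c x))
      expand-form x y = begin
        ω (c y +ᵛ (p y · c k)) (c x +ᵛ (p x · c k))
          ≡⟨ additive-⊕· (ω-additive _) (c x) (p x) (c k) ⟩
        ω (c y +ᵛ (p y · c k)) (c x) ℤ.+ + p x ℤ.* ω (c y +ᵛ (p y · c k)) (c k)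
          ≡⟨ cong₂ (λ a b → a ℤ.+ + p x ℤ.* b) (additive-⊕· (ωˡ (c x)) (c y) (p y) (c k))
               (trans (additive-⊕· (ωˡ (c k)) (c y) (p y) (c k))
                 (cong (λ b → ω (c y) (c k) ℤ.+ + p y ℤ.* b) (ω-alternating ω-additive ω-skew (c k)))) ⟩
        (ω (c y) (c x) ℤ.+ + p y ℤ.* ω (c k) (c x)) ℤ.+ + p x ℤ.* (ω (c y) (c k) ℤ.+ + p y ℤ.* 0ℤ)
          ≡⟨ lem (ω (c y) (c x)) (+ p x) (+ p y) (ω (c y) (c k)) (ω (c k) (c x)) ⟩
        ω (c y) (c x) ℤ.+ (+ p x ℤ.* ω (c y) (c k) ℤ.+ + p y ℤ.* ω (c k) (c x)) ∎
        where
        lem : ∀ w p q a b → (w ℤ.+ q ℤ.* b) ℤ.+ p ℤ.* (a ℤ.+ q ℤ.* 0ℤ) ≡ w ℤ.+ (p ℤ.* a ℤ.+ q ℤ.* b)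
        lem = solve-∀

      go : Dec (x ≡ k) → Dec (y ≡ k) → net (μ k a) x y ≡ ω (pivot k p c y) (pivot k p c x)
      go (yes refl) _          = source y
      go (no _)     (yes refl) = trans (net-swap (μ k a) x k)
        (trans (cong (λ i → ℤ.- i) (source x)) (sym (ω-skew (pivot k p c k) (pivot k p c x))))
      go (no x≢k)   (no y≢k)   = begin
        net (μ k a) x y
          ≡⟨ net-mutate-other _≟_ k a x≢k y≢k ⟩
        net a x y ℤ.+ (+ a x k ℤ.* + a k y ℤ.- + a y k ℤ.* + a k x)
          ≡⟨ cong (ℤ._+_ (net a x y)) (weights x y) ⟨
        net a x y ℤ.+ (+ p x ℤ.* net a k y ℤ.+ + p y ℤ.* net a x k)
          ≡⟨ cong₂ ℤ._+_ (pres x y) (cong₂ (λ a b → + p x ℤ.* a ℤ.+ + p y ℤ.* b) (pres k y) (pres x k)) ⟩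
        ω (c y) (c x) ℤ.+ (+ p x ℤ.* ω (c y) (c k) ℤ.+ + p y ℤ.* ω (c k) (c x))
          ≡⟨ expand-form x y ⟨
        ω (c y +ᵛ (p y · c k)) (c x +ᵛ (p x · c k))
          ≡⟨ cong₂ ω (pivot-≢ p c y≢k) (pivot-≢ p c x≢k) ⟨
        ω (pivot k p c y) (pivot k p c x) ∎

    record Realizes (f : Fin n → Lattice n → ℤ) (c : Fin n → Lattice n) (F : FQuiver n) : Set where
      field
        isQuiver : IsQuiver F
        mutable  : Presents c (mutablePart F)
        frozen   : ∀ x j → net F (inj₁ x) (inj₂ j) ≡ f j (c x)

    open Realizes

    module _ {f : Fin n → Lattice n → ℤ} where

      realizes-cong : ∀ {c c′ F} → c ≗ c′ → Realizes f c F → Realizes f c′ F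
      realizes-cong e r = record
        { isQuiver = isQuiver r
        ; mutable  = λ x y → trans (mutable r x y) (cong₂ ω (e y) (e x))
        ; frozen   = λ x j → trans (frozen r x j) (cong (f j) (e x))
        }

      realizes-green : ∀ {c F i} → Realizes f c F → Green F i → ∀ j → 0ℤ ℤ.≤ f j (c i)
      realizes-green {c} {F} {i} r green j =
        subst (0ℤ ℤ.≤_) (trans (cong (λ m → + F (inj₁ i) (inj₂ j) ℤ.- + m) (sym (green j))) (frozen r i j))
          (subst (0ℤ ℤ.≤_) (sym (ℤ.+-identityʳ _)) (ℤ.+≤+ ℕ.z≤n))

      green-realizes : ∀ {c F i} → Realizes f c F → (∀ j → 0ℤ ℤ.≤ f j (c i)) → Green F i
      green-realizes {c} {F} {i} r nonneg j = trans
        (arrows (isQuiver r) (inj₂ j) (inj₁ i)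
          (trans (net-swap F (inj₂ j) (inj₁ i)) (cong (λ z → ℤ.- z) (frozen r i j))))
        (pos-neg (f j (c i)) (nonneg j))
        where
        pos-neg : ∀ z → 0ℤ ℤ.≤ z → pos (ℤ.- z) ≡ 0
        pos-neg (+ zero) _ = refl
        pos-neg +[1+ _ ] _ = refl

      module _ (f-additive : ∀ j → Additive (f j)) where

        realizes-mutate : ∀ {c F k} → Realizes f c F → Green F k → Realizes f (mutateSeed′ k c) (μF k F)
        realizes-mutate {c} {F} {k} r green = record
          { isQuiver = μF-isQuiver k (isQuiver r)
          ; mutable  = λ x y → trans (cong₂ (λ m n → + m ℤ.- + n) (μF-mutablePart k F x y) (μF-mutablePart k F y x))
                                     (pivot-presents k p (mutable r) weights x y)
          ; frozen   = λ x j → frozen′ x j (x ≟ k)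
          }
          where
          open ≡-Reasoning
          a = mutablePart F
          p : Fin n → ℕ
          p x = pos (ω (c k) (c x))

          p-arrows : ∀ x → a x k ≡ p x
          p-arrows x = arrows (isQuiver r) (inj₁ x) (inj₁ k) (mutable r x k)

          lem : ∀ xk ky yk kx → xk ℤ.* (ky ℤ.- yk) ℤ.+ yk ℤ.* (xk ℤ.- kx) ≡ xk ℤ.* ky ℤ.- yk ℤ.* kx
          lem = solve-∀

          weights : ∀ x y → + p x ℤ.* net a k y ℤ.+ + p y ℤ.* net a x k ≡ + a x k ℤ.* + a k y ℤ.- + a y k ℤ.* + a k x
          weights x y = trans
            (cong₂ (λ m n → + m ℤ.* net a k y ℤ.+ + n ℤ.* net a x k) (sym (p-arrows x)) (sym (p-arrows y)))
            (lem (+ a x k) (+ a k y) (+ a y k) (+ a k x))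

          lem₂ : ∀ d m l z → d ℤ.+ (m ℤ.* l ℤ.- 0ℤ ℤ.* z) ≡ d ℤ.+ m ℤ.* (l ℤ.- 0ℤ)
          lem₂ = solve-∀

          frozen′ : ∀ x j → Dec (x ≡ k) → net (μF k F) (inj₁ x) (inj₂ j) ≡ f j (mutateSeed′ k c x)
          frozen′ x j (yes refl) = begin
            net (μF x F) (inj₁ x) (inj₂ j)      ≡⟨ net-mutate-source _≟V_ (inj₁ x) F (inj₂ j) ⟩
            net F (inj₂ j) (inj₁ x)             ≡⟨ net-swap F (inj₂ j) (inj₁ x) ⟩
            ℤ.- net F (inj₁ x) (inj₂ j)         ≡⟨ cong (λ z → ℤ.- z) (frozen r x j) ⟩
            ℤ.- f j (c x)                       ≡⟨ additive-⊖ (f-additive j) (c x) ⟨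
            f j (-ᵛ c x)                        ≡⟨ cong (f j) (pivot-≡ x p c) ⟨
            f j (mutateSeed′ x c x)             ∎
          frozen′ x j (no x≢k) = begin
            net (μF k F) (inj₁ x) (inj₂ j)
              ≡⟨ net-mutate-other _≟V_ (inj₁ k) F (λ e → x≢k (inj₁-injective e)) (λ ()) ⟩
            net F (inj₁ x) (inj₂ j) ℤ.+
              (+ a x k ℤ.* + F (inj₁ k) (inj₂ j) ℤ.- + F (inj₂ j) (inj₁ k) ℤ.* + a k x)
              ≡⟨ cong (λ m → net F (inj₁ x) (inj₂ j) ℤ.+ (+ a x k ℤ.* + F (inj₁ k) (inj₂ j) ℤ.- + m ℤ.* + a k x)) (green j) ⟩
            net F (inj₁ x) (inj₂ j) ℤ.+ (+ a x k ℤ.* + F (inj₁ k) (inj₂ j) ℤ.- 0ℤ ℤ.* + a k x)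
              ≡⟨ lem₂ (net F (inj₁ x) (inj₂ j)) (+ a x k) (+ F (inj₁ k) (inj₂ j)) (+ a k x) ⟩
            net F (inj₁ x) (inj₂ j) ℤ.+ + a x k ℤ.* (+ F (inj₁ k) (inj₂ j) ℤ.- 0ℤ)
              ≡⟨ cong (λ m → net F (inj₁ x) (inj₂ j) ℤ.+ + a x k ℤ.* (+ F (inj₁ k) (inj₂ j) ℤ.- + m)) (green j) ⟨
            net F (inj₁ x) (inj₂ j) ℤ.+ + a x k ℤ.* net F (inj₁ k) (inj₂ j)
              ≡⟨ cong₂ ℤ._+_ (frozen r x j) (cong₂ (λ m z → + m ℤ.* z) (p-arrows x) (frozen r k j)) ⟩
            f j (c x) ℤ.+ + p x ℤ.* f j (c k)
              ≡⟨ additive-⊕· (f-additive j) (c x) (p x) (c k) ⟨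
            f j (c x +ᵛ (p x · c k))
              ≡⟨ cong (f j) (pivot-≢ p c x≢k) ⟨
            f j (mutateSeed′ k c x) ∎

        realizes-mutateSeeds : ∀ {c F} is → Realizes f c F → GreenSeq F is →
                               Realizes f (mutateSeeds′ is c) (μSeqF is F)
        realizes-mutateSeeds []       r _              = r
        realizes-mutateSeeds (i ∷ is) r (green , rest) = realizes-mutateSeeds is (realizes-mutate r green) rest

        greenSeq⇒along : ∀ {c F} is → Realizes f c F → GreenSeq F is → Along′ (λ v → ∀ j → 0ℤ ℤ.≤ f j v) c is
        greenSeq⇒along []       r _              = tt
        greenSeq⇒along (i ∷ is) r (green , rest) = realizes-green r green , greenSeq⇒along is (realizes-mutate r green) rest

        along⇒greenSeq : ∀ {c F} is → Realizes f c F → Along′ (λ v → ∀ j → 0ℤ ℤ.≤ f j v) c is → GreenSeq F is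
        along⇒greenSeq []       r _         = tt
        along⇒greenSeq (i ∷ is) r (h , hs) =
          let green = green-realizes r h in green , along⇒greenSeq is (realizes-mutate r green) hs

sum-nonneg : ∀ {n} (t : Fin n → ℤ) → (∀ i → 0ℤ ℤ.≤ t i) → 0ℤ ℤ.≤ sum t
sum-nonneg {zero}  t nonneg = ℤ.≤-refl
sum-nonneg {suc n} t nonneg = ℤ.+-mono-≤ (nonneg zero) (sum-nonneg (λ i → t (suc i)) (λ i → nonneg (suc i)))

sum≡0⇒≡0 : ∀ {n} (t : Fin n → ℤ) → (∀ i → 0ℤ ℤ.≤ t i) → sum t ≡ 0ℤ → ∀ i → t i ≡ 0ℤ
sum≡0⇒≡0 {suc n} t nonneg e = λ where
    zero    → head≡0
    (suc i) → sum≡0⇒≡0 (λ j → t (suc j)) (λ j → nonneg (suc j)) rest≡0 i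
  where
  rest = sum (λ i → t (suc i))
  rest≥0 = sum-nonneg (λ i → t (suc i)) (λ i → nonneg (suc i))
  head≡0 : t zero ≡ 0ℤ
  head≡0 = ℤ.≤-antisym (ℤ.≤-trans (subst (ℤ._≤ t zero ℤ.+ rest) (ℤ.+-identityʳ (t zero)) (ℤ.+-monoʳ-≤ (t zero) rest≥0))
                                  (ℤ.≤-reflexive e))
                       (nonneg zero)
  rest≡0 : rest ≡ 0ℤ
  rest≡0 = trans (sym (ℤ.+-identityˡ rest)) (trans (cong (ℤ._+ rest) (sym head≡0)) e)

*-nonneg : ∀ m {i} → 0ℤ ℤ.≤ i → 0ℤ ℤ.≤ + m ℤ.* i
*-nonneg m {i} le = subst (ℤ._≤ + m ℤ.* i) (ℤ.*-zeroʳ (+ m)) (ℤ.*-monoˡ-≤-nonNeg (+ m) le)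

dual-nonneg : ∀ {n m} {c : Fin m → Lattice n} (db : DualBasis c) i x → 0ℤ ℤ.≤ DualBasis.dual db i (c x)
dual-nonneg db i x with i ≟ x
... | yes refl = subst (0ℤ ℤ.≤_) (sym (DualBasis.diagonal db i)) (ℤ.+≤+ ℕ.z≤n)
... | no ne    = ℤ.≤-reflexive (sym (DualBasis.off-diag db ne))

coord-cone : ∀ {n} → Lattice n → Set
coord-cone v = ∀ j → 0ℤ ℤ.≤ coord j v

module OffLine {n : ℕ} (k : Fin n) where

  offLine : Lattice n → ℤ
  offLine u = sum λ j → + (1 ∸ δ k j) ℤ.* coord j u

  offLine-additive : Additive offLine
  offLine-additive = sum-additive λ j → *-additive (+ (1 ∸ δ k j)) (coord-additive j)

  offLine-nonneg : ∀ {v} → coord-cone v → 0ℤ ℤ.≤ offLine v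
  offLine-nonneg {v} nonneg = sum-nonneg _ λ j → *-nonneg (1 ∸ δ k j) (nonneg j)

  offLine-basis : offLine (basis k) ≡ 0ℤ
  offLine-basis = sum-zero _ λ j → go j (k ≟ j)
    where
    go : ∀ j → Dec (k ≡ j) → + (1 ∸ δ k j) ℤ.* coord j (basis k) ≡ 0ℤ
    go j (yes refl) = cong (λ m → + (1 ∸ m) ℤ.* coord j (basis j)) (δ-diagonal j)
    go j (no ne)    = trans (cong (ℤ._*_ (+ (1 ∸ δ k j))) (trans (coord-basis j k) (cong +_ (δ-off-diag ne))))
                            (ℤ.*-zeroʳ (+ (1 ∸ δ k j)))

  offLine≡0⇒multiple : ∀ {v} → coord-cone v → offLine v ≡ 0ℤ → v ≡ pos (coord k v) · basis k
  offLine≡0⇒multiple {v} nonneg e = coord-injective λ j → trans (go j (k ≟ j)) (sym (additive-· (coord-additive j) (pos (coord k v)) (basis k)))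
    where
    pos-≡ : ∀ {i} → 0ℤ ℤ.≤ i → i ≡ + pos i
    pos-≡ {+ _} _ = refl
    term-nonneg : ∀ j → 0ℤ ℤ.≤ + (1 ∸ δ k j) ℤ.* coord j v
    term-nonneg j = *-nonneg (1 ∸ δ k j) (nonneg j)
    go : ∀ j → Dec (k ≡ j) → coord j v ≡ + pos (coord k v) ℤ.* coord j (basis k)
    go j (yes refl) = trans (pos-≡ (nonneg j)) (sym (trans
      (cong (ℤ._*_ (+ pos (coord j v))) (trans (coord-basis j j) (cong +_ (δ-diagonal j)))) (ℤ.*-identityʳ (+ pos (coord j v)))))
    go j (no ne) = trans
      (trans (sym (ℤ.*-identityˡ (coord j v)))
        (trans (cong (λ m → + (1 ∸ m) ℤ.* coord j v) (sym (δ-off-diag ne))) (sum≡0⇒≡0 _ term-nonneg e j)))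
      (sym (trans (cong (ℤ._*_ (+ pos (coord k v))) (trans (coord-basis j k) (cong +_ (δ-off-diag ne)))) (ℤ.*-zeroʳ (+ pos (coord k v)))))

  module _ {ω : Lattice n → Lattice n → ℤ}
    (ω-additive : ∀ u → Additive (ω u)) (ω-skew : ∀ u v → ω u v ≡ ℤ.- ω v u) where

    -- An earlier crossed vector m e_k would leave - m e_k in the mutated seed; the coordinate dual to it is then
    -- negative on e_k, the vector crossed last, against positivity.
    along-offLine : ∀ {c : Fin n → Lattice n} is i → DualBasis c → Along ω-additive ω-skew coord-cone c is →
                    mutateSeeds ω-additive ω-skew is c i ≡ basis k →
                    Along ω-additive ω-skew (λ v → 0ℤ ℤ.< offLine v) c is
    along-offLine []            i db _            last = tt
    along-offLine {c} (i₀ ∷ is) i db (cone , rest) last =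
      ℤ.≤∧≢⇒< (offLine-nonneg {v = c i₀} cone) (λ e → on-line (sym e)) , above
      where
      db′ = mutateSeed-dualBasis ω-additive ω-skew i₀ db
      above = along-offLine is i db′ rest last
      open DualBasis db′ renaming (dual to g)

      g-basis : 0ℤ ℤ.≤ g i₀ (basis k)
      g-basis = subst (λ v → 0ℤ ℤ.≤ g i₀ v) last
        (positivity ω-additive ω-skew is i db′ (dual-additive i₀) offLine-additive (dual-nonneg db′ i₀) above
          (trans (cong offLine last) offLine-basis))

      g-mutated : ℤ.- g i₀ (c i₀) ≡ 1ℤ
      g-mutated = trans (sym (additive-⊖ (dual-additive i₀) (c i₀)))
        (trans (cong (g i₀) (sym (pivot-≡ i₀ _ c))) (diagonal i₀))

      on-line : offLine (c i₀) ≢ 0ℤ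
      on-line e = contradiction
        (ℤ.neg-mono-≤ (subst (0ℤ ℤ.≤_) (sym eq) (*-nonneg m g-basis)))
        (subst (λ z → ¬ (z ℤ.≤ 0ℤ)) (sym g-mutated) λ { (ℤ.+≤+ ()) })
        where
        m = pos (coord k (c i₀))
        eq : g i₀ (c i₀) ≡ + m ℤ.* g i₀ (basis k)
        eq = trans (cong (g i₀) (offLine≡0⇒multiple {c i₀} cone e)) (additive-· (dual-additive i₀) m (basis k))

module Rotation {n : ℕ} (Q : Quiver n) (isQ : IsQuiver Q) (k : Fin n) where

  open Form Q
  open Realization ω-additive ω-skew
  open OffLine k

  private
    Q′ = μ k Q
    -- The initial seed of the framed quiver of μ k Q, in the lattice of Q.
    E  = pivot k (Q k) basis
    isQ′ = mutate-isQuiver _≟_ k Q isQ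

    seedAt : List (Fin n) → Fin n → Lattice n
    seedAt is = mutateSeeds ω-additive ω-skew is basis

    AlongQ : (Lattice n → Set) → List (Fin n) → Set
    AlongQ P = Along ω-additive ω-skew P basis

  E-dualBasis : DualBasis E
  E-dualBasis = pivot-dualBasis basis-dualBasis k (Q k) (proj₁ isQ k)

  open DualBasis E-dualBasis renaming (dual to coord′; dual-additive to coord′-additive)

  basis-presents : Presents basis Q
  basis-presents x y = sym (ω-basis y x)

  framed-realizes : Realizes coord basis (framed Q)
  framed-realizes = record
    { isQuiver = framed-isQuiver isQ
    ; mutable  = basis-presents
    ; frozen   = λ x j → trans (ℤ.+-identityʳ (+ δ x j)) (sym (coord-basis j x))
    }

  E-presents : Presents E Q′
  E-presents = pivot-presents k (Q k) basis-presents λ x y → lem (+ Q x k) (+ Q k y) (+ Q y k) (+ Q k x)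
    where
    lem : ∀ xk ky yk kx → kx ℤ.* (ky ℤ.- yk) ℤ.+ ky ℤ.* (xk ℤ.- kx) ≡ xk ℤ.* ky ℤ.- yk ℤ.* kx
    lem = solve-∀

  δ-coord′ : ∀ x j → + δ x j ≡ coord′ j (E x)
  δ-coord′ x j = go (j ≟ x)
    where
    go : Dec (j ≡ x) → + δ x j ≡ coord′ j (E x)
    go (yes refl) = trans (cong +_ (δ-diagonal j)) (sym (diagonal j))
    go (no ne)    = trans (cong +_ (δ-off-diag (λ e → ne (sym e)))) (sym (off-diag ne))

  framed′-realizes : Realizes coord′ E (framed Q′)
  framed′-realizes = record
    { isQuiver = framed-isQuiver isQ′
    ; mutable  = E-presents
    ; frozen   = λ x j → trans (ℤ.+-identityʳ (+ δ x j)) (δ-coord′ x j)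
    }

  mutate-E : mutateSeed ω-additive ω-skew k E ≗ basis
  mutate-E x = go (x ≟ k)
    where
    open ≡-Reasoning
    p : Fin n → ℕ
    p x = pos (ω (E k) (E x))
    p-≡ : ∀ {x} → x ≢ k → p x ≡ Q k x
    p-≡ {x} ne = trans (sym (arrows isQ′ x k (E-presents x k))) (mutate-target _≟_ k Q ne)
    lem : ∀ a m b → (a ℤ.+ m ℤ.* b) ℤ.+ m ℤ.* ℤ.- b ≡ a
    lem = solve-∀
    go : Dec (x ≡ k) → pivot k p E x ≡ basis x
    go (yes refl) = coord-injective λ j → begin
      coord j (pivot x p E x)             ≡⟨ cong (coord j) (trans (pivot-≡ x p E) (cong -ᵛ_ (pivot-≡ x (Q x) basis))) ⟩
      coord j (-ᵛ (-ᵛ basis x))           ≡⟨ trans (additive-⊖ (coord-additive j) (-ᵛ basis x))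
                                               (cong (λ z → ℤ.- z) (additive-⊖ (coord-additive j) (basis x))) ⟩
      ℤ.- (ℤ.- coord j (basis x))         ≡⟨ ℤ.neg-involutive _ ⟩
      coord j (basis x)                   ∎
    go (no ne) = coord-injective λ j → begin
      coord j (pivot k p E x)
        ≡⟨ cong (coord j) (trans (pivot-≢ p E ne) (cong₂ (λ v w → v +ᵛ (p x · w)) (pivot-≢ (Q k) basis ne) (pivot-≡ k (Q k) basis))) ⟩
      coord j ((basis x +ᵛ (Q k x · basis k)) +ᵛ (p x · (-ᵛ basis k)))
        ≡⟨ additive-⊕· (coord-additive j) (basis x +ᵛ (Q k x · basis k)) (p x) (-ᵛ basis k) ⟩
      coord j (basis x +ᵛ (Q k x · basis k)) ℤ.+ + p x ℤ.* coord j (-ᵛ basis k)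
        ≡⟨ cong₂ ℤ._+_ (additive-⊕· (coord-additive j) (basis x) (Q k x) (basis k))
             (cong₂ (λ m z → + m ℤ.* z) (p-≡ ne) (additive-⊖ (coord-additive j) (basis k))) ⟩
      (coord j (basis x) ℤ.+ + Q k x ℤ.* coord j (basis k)) ℤ.+ + Q k x ℤ.* ℤ.- coord j (basis k)
        ≡⟨ lem (coord j (basis x)) (+ Q k x) (coord j (basis k)) ⟩
      coord j (basis x) ∎

  coord′-nonneg : ∀ pre i → AlongQ (λ v → 0ℤ ℤ.< offLine v × 0ℤ ℤ.≤ coord′ k v) pre →
                  0ℤ ℤ.< offLine (seedAt pre i) → 0ℤ ℤ.≤ coord′ k (seedAt pre i)
  coord′-nonneg pre i above D>0 = case (coord′ k γ) refl
    where
    γ = seedAt pre i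
    D = offLine γ

    E-path : mutateSeeds ω-additive ω-skew (k ∷ pre) E ≗ seedAt pre
    E-path = mutateSeeds-cong ω-additive ω-skew pre mutate-E

    case : ∀ z → coord′ k γ ≡ z → 0ℤ ℤ.≤ coord′ k γ
    case (+ m)    e = subst (0ℤ ℤ.≤_) (sym e) (ℤ.+≤+ ℕ.z≤n)
    case -[1+ m ] e = subst (λ v → 0ℤ ℤ.≤ coord′ k v) (E-path i)
      (positivity ω-additive ω-skew (k ∷ pre) i E-dualBasis (coord′-additive k) l-additive
        (dual-nonneg E-dualBasis k) (l-Ek , l-above) l-level)
      where
      open ≡-Reasoning
      M = +[1+ m ]
      -- Positive on every vector crossed so far, but zero on γ.
      l : Lattice n → ℤ
      l u = M ℤ.* offLine u ℤ.+ D ℤ.* coord′ k u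

      l-additive : Additive l
      l-additive = +-additive (*-additive M offLine-additive) (*-additive D (coord′-additive k))

      lem₀ : ∀ M D → M ℤ.* 0ℤ ℤ.+ D ℤ.* 1ℤ ≡ D
      lem₀ = solve-∀
      l-Ek : 0ℤ ℤ.< l (E k)
      l-Ek = subst (0ℤ ℤ.<_) (sym (trans
        (cong₂ (λ a b → M ℤ.* a ℤ.+ D ℤ.* b)
          (trans (cong offLine (pivot-≡ k (Q k) basis))
            (trans (additive-⊖ offLine-additive (basis k)) (cong (λ z → ℤ.- z) offLine-basis)))
          (diagonal k)) (lem₀ M D))) D>0

      instance
        D-nonNegative : ℤ.NonNegative D
        D-nonNegative = ℤ.nonNegative (ℤ.<⇒≤ D>0)

      l-positive : ∀ {v} → 0ℤ ℤ.< offLine v × 0ℤ ℤ.≤ coord′ k v → 0ℤ ℤ.< l v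
      l-positive {v} (d>0 , c≥0) = ℤ.+-mono-<-≤
        (subst (ℤ._< M ℤ.* offLine v) (ℤ.*-zeroʳ M) (ℤ.*-monoˡ-<-pos M d>0))
        (subst (ℤ._≤ D ℤ.* coord′ k v) (ℤ.*-zeroʳ D) (ℤ.*-monoˡ-≤-nonNeg D c≥0))

      l-above : Along ω-additive ω-skew (λ v → 0ℤ ℤ.< l v) (mutateSeed ω-additive ω-skew k E) pre
      l-above = along-cong ω-additive ω-skew pre (λ x → sym (mutate-E x))
        (along-map ω-additive ω-skew basis pre (λ {v} → l-positive {v}) above)

      lem₁ : ∀ M D → M ℤ.* D ℤ.+ D ℤ.* ℤ.- M ≡ 0ℤ
      lem₁ = solve-∀
      l-level : l (mutateSeeds ω-additive ω-skew (k ∷ pre) E i) ≡ 0ℤ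
      l-level = begin
        l (mutateSeeds ω-additive ω-skew (k ∷ pre) E i)   ≡⟨ cong l (E-path i) ⟩
        M ℤ.* D ℤ.+ D ℤ.* coord′ k γ                      ≡⟨ cong (λ z → M ℤ.* D ℤ.+ D ℤ.* z) e ⟩
        M ℤ.* D ℤ.+ D ℤ.* ℤ.- M                           ≡⟨ lem₁ M D ⟩
        0ℤ                                                ∎

  along-coord′ : ∀ is → AlongQ (λ v → 0ℤ ℤ.< offLine v) is → AlongQ (λ v → 0ℤ ℤ.≤ coord′ k v) is
  along-coord′ is above =
    along-map ω-additive ω-skew basis is proj₂ (go [] is tt above)
    where
    Good : Lattice n → Set
    Good v = 0ℤ ℤ.< offLine v × 0ℤ ℤ.≤ coord′ k v
    go : ∀ pre post → AlongQ Good pre → AlongQ (λ v → 0ℤ ℤ.< offLine v) (pre ++ post) → AlongQ Good (pre ++ post)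
    go pre []         good above = subst (AlongQ Good) (sym (++-identityʳ pre)) good
    go pre (i ∷ post) good above =
      let D>0 = proj₁ (proj₂ (along-++⁻ ω-additive ω-skew basis pre above))
          assoc = ++-assoc pre (i ∷ []) post
      in subst (AlongQ Good) assoc
           (go (pre ++ i ∷ []) post
             (along-++⁺ ω-additive ω-skew basis pre good ((D>0 , coord′-nonneg pre i good D>0) , tt))
             (subst (AlongQ (λ v → 0ℤ ℤ.< offLine v)) (sym assoc) above))

  along-cone′ : ∀ is → AlongQ coord-cone is → AlongQ (λ v → 0ℤ ℤ.≤ coord′ k v) is →
                AlongQ (λ v → ∀ j → 0ℤ ℤ.≤ coord′ j v) is
  along-cone′ is cone nonneg = go basis is cone nonneg
    where
    one : ∀ v → coord-cone v → 0ℤ ℤ.≤ coord′ k v → ∀ j → Dec (j ≡ k) → 0ℤ ℤ.≤ coord′ j v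
    one v cone nonneg j (yes refl) = nonneg
    one v cone nonneg j (no ne)    =
      subst (0ℤ ℤ.≤_) (sym (dual-pivot-≢ basis-dualBasis k (Q k) (proj₁ isQ k) ne v)) (cone j)
    go : ∀ c is → Along ω-additive ω-skew coord-cone c is → Along ω-additive ω-skew (λ v → 0ℤ ℤ.≤ coord′ k v) c is →
         Along ω-additive ω-skew (λ v → ∀ j → 0ℤ ℤ.≤ coord′ j v) c is
    go c []       _        _        = tt
    go c (i ∷ is) (h , hs) (p , ps) = (λ j → one (c i) h p j (j ≟ k)) , go _ is hs ps

  start-realizes : Realizes coord′ basis (μF k (framed Q′))
  start-realizes = realizes-cong mutate-E (realizes-mutate coord′-additive framed′-realizes (λ _ → refl))

greenSeq-++⁻ : ∀ {n} {F : FQuiver n} is {js} → GreenSeq F (is ++ js) → GreenSeq F is × GreenSeq (μSeqF is F) js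
greenSeq-++⁻ []       g       = tt , g
greenSeq-++⁻ (i ∷ is) (h , g) = let g₁ , g₂ = greenSeq-++⁻ is g in (h , g₁) , g₂

μSeqF-++ : ∀ {n} {F : FQuiver n} is {js} → μSeqF (is ++ js) F ≡ μSeqF js (μSeqF is F)
μSeqF-++ []       = refl
μSeqF-++ (i ∷ is) = μSeqF-++ is

μSeqF-frozen : ∀ {n} {F : FQuiver n} k is i j → μSeqF is (μF k F) (inj₂ i) (inj₂ j) ≡ 0
μSeqF-frozen k []       i j = refl
μSeqF-frozen k (l ∷ is) i j = μSeqF-frozen l is i j

theorem2p14 : (n : ℕ) (Q : Quiver n) → IsQuiver Q →
    (is : List (Fin n)) (iℓ : Fin n) (σ : Permutation′ n) →
    IsMaxGreenSeq Q (is ++ [ iℓ ]) → IsInducedPerm Q (is ++ [ iℓ ]) σ →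
    IsMaxGreenSeq (μ (σ ⟨$⟩ʳ iℓ) Q) ((σ ⟨$⟩ʳ iℓ) ∷ is)
    × IsInducedPerm (μ (σ ⟨$⟩ʳ iℓ) Q) ((σ ⟨$⟩ʳ iℓ) ∷ is) σ
theorem2p14 n Q isQ is iℓ σ (greens , _) induced = (((λ _ → refl) , greens′) , reds′) , induced′
  where
  open ≡-Reasoning
  k = σ ⟨$⟩ʳ iℓ
  open Form Q
  open Realization ω-additive ω-skew
  open Realizes
  open Rotation Q isQ k
  open OffLine k
  open DualBasis E-dualBasis using () renaming (dual to coord′; dual-additive to coord′-additive)
  E = pivot k (Q k) basis

  F = μSeqF is (framed Q)
  c = mutateSeeds ω-additive ω-skew is basis

  greens₁ : GreenSeq (framed Q) is
  greens₁ = proj₁ (greenSeq-++⁻ is greens)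

  F-realizes : Realizes coord c F
  F-realizes = realizes-mutateSeeds coord-additive is framed-realizes greens₁

  F-green : Green F iℓ
  F-green = proj₁ (proj₂ (greenSeq-++⁻ is greens))

  cℓ = mutateSeed ω-additive ω-skew iℓ c

  Fℓ-realizes : Realizes coord cℓ (μF iℓ F)
  Fℓ-realizes = realizes-mutate coord-additive F-realizes F-green

  induced-ℓ : ∀ x y → coframed Q (liftPerm σ x) (liftPerm σ y) ≡ μF iℓ F x y
  induced-ℓ x y = trans (induced x y) (cong (λ G → G x y) (μSeqF-++ is))

  cℓ-coord : ∀ x j → coord j (cℓ x) ≡ ℤ.- + δ (σ ⟨$⟩ʳ x) j
  cℓ-coord x j = begin
    coord j (cℓ x)                                          ≡⟨ frozen Fℓ-realizes x j ⟨
    net (μF iℓ F) (inj₁ x) (inj₂ j)                         ≡⟨ cong₂ (λ m m′ → + m ℤ.- + m′) (induced-ℓ (inj₁ x) (inj₂ j)) (induced-ℓ (inj₂ j) (inj₁ x)) ⟨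
    0ℤ ℤ.- + δ j (σ ⟨$⟩ʳ x)                                 ≡⟨ ℤ.+-identityˡ _ ⟩
    ℤ.- + δ j (σ ⟨$⟩ʳ x)                                    ≡⟨ cong (λ m → ℤ.- + m) (δ-sym j (σ ⟨$⟩ʳ x)) ⟩
    ℤ.- + δ (σ ⟨$⟩ʳ x) j                                    ∎

  c-last : c iℓ ≡ basis k
  c-last = coord-injective λ j → begin
    coord j (c iℓ)                ≡⟨ ℤ.neg-involutive _ ⟨
    ℤ.- (ℤ.- coord j (c iℓ))      ≡⟨ cong (λ z → ℤ.- z) (additive-⊖ (coord-additive j) (c iℓ)) ⟨
    ℤ.- coord j (-ᵛ c iℓ)         ≡⟨ cong (λ v → ℤ.- coord j v) (pivot-≡ iℓ _ c) ⟨
    ℤ.- coord j (cℓ iℓ)           ≡⟨ cong (λ z → ℤ.- z) (cℓ-coord iℓ j) ⟩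
    ℤ.- (ℤ.- + δ k j)             ≡⟨ ℤ.neg-involutive _ ⟩
    + δ k j                       ≡⟨ coord-basis j k ⟨
    coord j (basis k)             ∎

  c-final : ∀ x → c x ≡ -ᵛ E (σ ⟨$⟩ʳ x)
  c-final x = go (x ≟ iℓ)
    where
    lem : ∀ a m b → a ≡ (a ℤ.+ m ℤ.* b) ℤ.- m ℤ.* b
    lem = solve-∀
    lem₂ : ∀ a b → ℤ.- a ℤ.- b ≡ ℤ.- (a ℤ.+ b)
    lem₂ = solve-∀
    go : Dec (x ≡ iℓ) → c x ≡ -ᵛ E (σ ⟨$⟩ʳ x)
    go (yes refl) = coord-injective λ j → begin
      coord j (c x)                       ≡⟨ cong (coord j) c-last ⟩
      coord j (basis k)                   ≡⟨ ℤ.neg-involutive _ ⟨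
      ℤ.- (ℤ.- coord j (basis k))         ≡⟨ cong (λ z → ℤ.- z) (additive-⊖ (coord-additive j) (basis k)) ⟨
      ℤ.- coord j (-ᵛ basis k)            ≡⟨ cong (λ v → ℤ.- coord j v) (pivot-≡ k (Q k) basis) ⟨
      ℤ.- coord j (E k)                   ≡⟨ additive-⊖ (coord-additive j) (E k) ⟨
      coord j (-ᵛ E k)                    ∎
    go (no ne) = coord-injective λ j → begin
      coord j (c x)
        ≡⟨ lem (coord j (c x)) (+ p) (coord j (c iℓ)) ⟩
      (coord j (c x) ℤ.+ + p ℤ.* coord j (c iℓ)) ℤ.- + p ℤ.* coord j (c iℓ)
        ≡⟨ cong (ℤ._- + p ℤ.* coord j (c iℓ)) (trans (cong (coord j) (pivot-≢ _ c ne)) (additive-⊕· (coord-additive j) (c x) p (c iℓ))) ⟨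
      coord j (cℓ x) ℤ.- + p ℤ.* coord j (c iℓ)
        ≡⟨ cong₂ ℤ._-_ (cℓ-coord x j) (cong₂ (λ m v → + m ℤ.* coord j v) p-≡ c-last) ⟩
      ℤ.- + δ (σ ⟨$⟩ʳ x) j ℤ.- + Q k (σ ⟨$⟩ʳ x) ℤ.* coord j (basis k)
        ≡⟨ cong (λ z → ℤ.- z ℤ.- + Q k (σ ⟨$⟩ʳ x) ℤ.* coord j (basis k)) (coord-basis j (σ ⟨$⟩ʳ x)) ⟨
      ℤ.- coord j (basis (σ ⟨$⟩ʳ x)) ℤ.- + Q k (σ ⟨$⟩ʳ x) ℤ.* coord j (basis k)
        ≡⟨ lem₂ (coord j (basis (σ ⟨$⟩ʳ x))) _ ⟩
      ℤ.- (coord j (basis (σ ⟨$⟩ʳ x)) ℤ.+ + Q k (σ ⟨$⟩ʳ x) ℤ.* coord j (basis k))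
        ≡⟨ cong (λ z → ℤ.- z) (trans (cong (coord j) (pivot-≢ (Q k) basis σx≢k))
             (additive-⊕· (coord-additive j) (basis (σ ⟨$⟩ʳ x)) (Q k (σ ⟨$⟩ʳ x)) (basis k))) ⟨
      ℤ.- coord j (E (σ ⟨$⟩ʳ x))
        ≡⟨ additive-⊖ (coord-additive j) (E (σ ⟨$⟩ʳ x)) ⟨
      coord j (-ᵛ E (σ ⟨$⟩ʳ x)) ∎
      where
      p = pos (ω (c iℓ) (c x))
      σx≢k : σ ⟨$⟩ʳ x ≢ k
      σx≢k e = ne (trans (sym (permutation-inverseˡ σ)) (trans (cong (σ ⟨$⟩ˡ_) e) (permutation-inverseˡ σ)))
      p-≡ : p ≡ Q k (σ ⟨$⟩ʳ x)
      p-≡ = begin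
        p                                   ≡⟨ arrows (isQuiver F-realizes) (inj₁ x) (inj₁ iℓ) (mutable F-realizes x iℓ) ⟨
        F (inj₁ x) (inj₁ iℓ)                ≡⟨ mutate-source _≟V_ (inj₁ iℓ) F (inj₁ x) ⟨
        μF iℓ F (inj₁ iℓ) (inj₁ x)          ≡⟨ induced-ℓ (inj₁ iℓ) (inj₁ x) ⟨
        Q k (σ ⟨$⟩ʳ x)                      ∎

  cone : Along ω-additive ω-skew coord-cone basis is
  cone = greenSeq⇒along coord-additive is framed-realizes greens₁

  greens′ : GreenSeq (μF k (framed (μ k Q))) is
  greens′ = along⇒greenSeq coord′-additive is start-realizes
    (along-cone′ is cone (along-coord′ is (along-offLine ω-additive ω-skew is iℓ basis-dualBasis cone c-last)))

  F′ = μSeqF is (μF k (framed (μ k Q)))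

  F′-realizes : Realizes coord′ c F′
  F′-realizes = realizes-mutateSeeds coord′-additive is start-realizes greens′

  frozen′ : ∀ x j → net F′ (inj₁ x) (inj₂ j) ≡ ℤ.- + δ j (σ ⟨$⟩ʳ x)
  frozen′ x j = begin
    net F′ (inj₁ x) (inj₂ j)            ≡⟨ frozen F′-realizes x j ⟩
    coord′ j (c x)                      ≡⟨ cong (coord′ j) (c-final x) ⟩
    coord′ j (-ᵛ E (σ ⟨$⟩ʳ x))          ≡⟨ additive-⊖ (coord′-additive j) (E (σ ⟨$⟩ʳ x)) ⟩
    ℤ.- coord′ j (E (σ ⟨$⟩ʳ x))         ≡⟨ cong (λ z → ℤ.- z) (δ-coord′ (σ ⟨$⟩ʳ x) j) ⟨
    ℤ.- + δ (σ ⟨$⟩ʳ x) j                ≡⟨ cong (λ m → ℤ.- + m) (δ-sym (σ ⟨$⟩ʳ x) j) ⟩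
    ℤ.- + δ j (σ ⟨$⟩ʳ x)                ∎

  pos-neg : ∀ m → pos (ℤ.- + m) ≡ 0
  pos-neg zero    = refl
  pos-neg (suc m) = refl

  isQ′ : IsQuiver (μ k Q)
  isQ′ = mutate-isQuiver _≟_ k Q isQ

  induced′ : IsInducedPerm (μ k Q) (k ∷ is) σ
  induced′ (inj₁ x) (inj₁ y) = trans (arrows isQ′ (σ ⟨$⟩ʳ x) (σ ⟨$⟩ʳ y) refl)
    (sym (arrows (isQuiver F′-realizes) (inj₁ x) (inj₁ y) (begin
      net F′ (inj₁ x) (inj₁ y)                                      ≡⟨ mutable F′-realizes x y ⟩
      ω (c y) (c x)                                                 ≡⟨ cong₂ ω (c-final y) (c-final x) ⟩
      ω (-ᵛ E (σ ⟨$⟩ʳ y)) (-ᵛ E (σ ⟨$⟩ʳ x))                         ≡⟨ trans (additive-⊖ (ω-additive (-ᵛ E (σ ⟨$⟩ʳ y))) (E (σ ⟨$⟩ʳ x)))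
                                                                         (cong (λ z → ℤ.- z) (additive-⊖ (ω-additiveˡ ω-additive ω-skew (E (σ ⟨$⟩ʳ x))) (E (σ ⟨$⟩ʳ y)))) ⟩
      ℤ.- (ℤ.- ω (E (σ ⟨$⟩ʳ y)) (E (σ ⟨$⟩ʳ x)))                     ≡⟨ ℤ.neg-involutive _ ⟩
      ω (E (σ ⟨$⟩ʳ y)) (E (σ ⟨$⟩ʳ x))                               ≡⟨ E-presents (σ ⟨$⟩ʳ x) (σ ⟨$⟩ʳ y) ⟨
      net (μ k Q) (σ ⟨$⟩ʳ x) (σ ⟨$⟩ʳ y)                             ∎)))
  induced′ (inj₁ x) (inj₂ j) = sym (trans (arrows (isQuiver F′-realizes) (inj₁ x) (inj₂ j) (frozen′ x j)) (pos-neg (δ j (σ ⟨$⟩ʳ x))))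
  induced′ (inj₂ j) (inj₁ x) = sym (arrows (isQuiver F′-realizes) (inj₂ j) (inj₁ x) (begin
    net F′ (inj₂ j) (inj₁ x)              ≡⟨ net-swap F′ (inj₂ j) (inj₁ x) ⟩
    ℤ.- net F′ (inj₁ x) (inj₂ j)          ≡⟨ cong (λ z → ℤ.- z) (frozen′ x j) ⟩
    ℤ.- (ℤ.- + δ j (σ ⟨$⟩ʳ x))            ≡⟨ ℤ.neg-involutive _ ⟩
    + δ j (σ ⟨$⟩ʳ x)                      ∎))
  induced′ (inj₂ i) (inj₂ j) = sym (μSeqF-frozen k is i j)

  reds′ : ∀ i → Red F′ i
  reds′ i j = sym (induced′ (inj₁ i) (inj₂ j))
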